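{- If $r$ divides $s$, then each of $\nu(n,P^{(r)}_s)$, $\nu^*(n,P^{(r)}_s)$ and $\tau^*(n,P^{(r)}_s)$ equals $\left(\left(\frac{r}{s}\right)^r+o(1)\right)\binom{n}{r}$, where $o(1)\to0$ as $n\to\infty$ with $r,s$ fixed.
   Context: $K^{(r)}_n$ is the ordered complete $r$-uniform hypergraph on $[n]=\{1,\dots,n\}$ with its natural order; a copy of an ordered hypergraph $H$ in $K^{(r)}_n$ is the image of $H$ under an order-preserving injection $V(H)\to[n]$. The natural path $P^{(r)}_s$ has vertices $v_1<\dots<v_s$ and edges all sets of $r$ consecutive vertices $\{v_j,\dots,v_{j+r-1}\}$, $1\le j\le s-r+1$. $\nu(n,H)$ is the maximum number of pairwise edge-disjoint copies of $H$ in $K^{(r)}_n$. A fractional $H$-transversal is a function $w:E(K^{(r)}_n)\to[0,\infty)$ with $\sum_{e\in E(H')}w(e)\ge1$ for every copy $H'$ of $H$; $\tau^*(n,H)$ is the minimum total weight of a fractional $H$-transversal. A fractional $H$-packing is an assignment of weights $w(H')\ge0$ to the copies $H'$ of $H$ in $K^{(r)}_n$ such that for each edge $e$ of $K^{(r)}_n$ the total weight of copies containing $e$ is at most $1$; $\nu^*(n,H)$ is the maximum total weight of a fractional $H$-packing. -}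

module Defs where

open import Data.Fin using (Fin; zero; suc; toℕ)
open import Data.Fin.Properties using (any?; all?)
open import Data.Integer using (+_)
open import Data.List using (List; []; _∷_; _++_; map; filter; foldr; length)
open import Data.List.Membership.DecPropositional using () renaming (_∈?_ to mem?)
open import Data.List.Membership.Propositional using (_∈_)
open import Data.List.Relation.Binary.Disjoint.Propositional using (Disjoint)
open import Data.List.Relation.Unary.AllPairs using (AllPairs)
open import Data.Nat as ℕ using (ℕ; zero; suc; _∸_; _⊔_)
open import Data.Nat.Combinatorics using (_C_)
import Data.Nat.Properties as ℕₚ
open import Data.Product using (∃; _×_; _,_)
open import Data.Rational as ℚ using (ℚ; 0ℚ; 1ℚ; ½; _/_; ∣_∣)
import Data.Rational.Properties as ℚₚ
import Data.Rational.Solver as ℚSolver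
open import Function using (flip)
open import Level using (0ℓ)
open import Relation.Binary using (Rel; DecidableEquality)
open import Relation.Binary.PropositionalEquality using (_≡_; _≢_; refl; cong; sym; trans; subst)
open import Relation.Nullary using (yes; no)
open import Relation.Unary using (Pred; Decidable)

------------------------------------------------------------------------
-- Real numbers: Cauchy sequences of rationals, compared by _≃_.

record ℝ : Set where
  constructor mkℝ
  field
    seq    : ℕ → ℚ
    cauchy : ∀ ε → 0ℚ ℚ.< ε → ∃ λ N → ∀ m n → N ℕ.≤ m → N ℕ.≤ n →
             ∣ seq m ℚ.- seq n ∣ ℚ.≤ ε

open ℝ public

infix 4 _≤ℝ_ _≃_

_≤ℝ_ : Rel ℝ 0ℓ
x ≤ℝ y = ∀ ε → 0ℚ ℚ.< ε → ∃ λ N → ∀ n → N ℕ.≤ n → seq x n ℚ.≤ seq y n ℚ.+ ε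

_≃_ : Rel ℝ 0ℓ
x ≃ y = x ≤ℝ y × y ≤ℝ x

fromℚ : ℚ → ℝ
fromℚ q = mkℝ (λ _ → q) λ ε 0<ε → 0 , λ _ _ _ _ →
  subst (ℚ._≤ ε) (sym (cong ∣_∣ (ℚₚ.+-inverseʳ q))) (ℚₚ.<⇒≤ 0<ε)

0ℝ 1ℝ : ℝ
0ℝ = fromℚ 0ℚ
1ℝ = fromℚ 1ℚ

fromℕ : ℕ → ℝ
fromℕ k = fromℚ (+ k / 1)

infixl 6 _+ℝ_

_+ℝ_ : ℝ → ℝ → ℝ
seq    (x +ℝ y) n = seq x n ℚ.+ seq y n
cauchy (x +ℝ y) ε 0<ε
  with cauchy x (½ ℚ.* ε) half | cauchy y (½ ℚ.* ε) half
  where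
  half : 0ℚ ℚ.< ½ ℚ.* ε
  half = subst (ℚ._< ½ ℚ.* ε) (ℚₚ.*-zeroʳ ½) (ℚₚ.*-monoʳ-<-pos ½ 0<ε)
... | M , p | N , q = M ⊔ N , λ m n M⊔N≤m M⊔N≤n → begin
  ∣ (seq x m ℚ.+ seq y m) ℚ.- (seq x n ℚ.+ seq y n) ∣
    ≡⟨ cong ∣_∣ (solve 4 (λ a b c d → (a :+ b) :- (c :+ d) := (a :- c) :+ (b :- d))
                 refl (seq x m) (seq y m) (seq x n) (seq y n)) ⟩
  ∣ (seq x m ℚ.- seq x n) ℚ.+ (seq y m ℚ.- seq y n) ∣
    ≤⟨ ℚₚ.∣p+q∣≤∣p∣+∣q∣ (seq x m ℚ.- seq x n) (seq y m ℚ.- seq y n) ⟩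
  ∣ seq x m ℚ.- seq x n ∣ ℚ.+ ∣ seq y m ℚ.- seq y n ∣
    ≤⟨ ℚₚ.+-mono-≤ (p m n (ℕₚ.m⊔n≤o⇒m≤o M N M⊔N≤m) (ℕₚ.m⊔n≤o⇒m≤o M N M⊔N≤n))
                   (q m n (ℕₚ.m⊔n≤o⇒n≤o M N M⊔N≤m) (ℕₚ.m⊔n≤o⇒n≤o M N M⊔N≤n)) ⟩
  ½ ℚ.* ε ℚ.+ ½ ℚ.* ε
    ≡⟨ trans (sym (ℚₚ.*-distribʳ-+ ε ½ ½)) (ℚₚ.*-identityˡ ε) ⟩
  ε ∎
  where
  open ℚₚ.≤-Reasoning
  open ℚSolver.+-*-Solver

sumOver : {A : Set} → List A → (A → ℝ) → ℝ
sumOver xs f = foldr (λ a t → f a +ℝ t) 0ℝ xs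

------------------------------------------------------------------------
-- Order-preserving injections {0,…,k-1} → {0,…,n-1}, as thinnings, so
-- that propositional equality is equality of maps.  Such an injection is
-- also the increasing enumeration of a k-element subset of [n].

data Embedding : ℕ → ℕ → Set where
  done : Embedding 0 0
  skip : ∀ {k n} → Embedding k n → Embedding k (suc n)
  keep : ∀ {k n} → Embedding k n → Embedding (suc k) (suc n)

infixl 9 _⟨$⟩_
infixr 9 _⊙_

_⟨$⟩_ : ∀ {k n} → Embedding k n → Fin k → Fin n
skip f ⟨$⟩ i     = suc (f ⟨$⟩ i)
keep f ⟨$⟩ zero  = zero
keep f ⟨$⟩ suc i = suc (f ⟨$⟩ i)

-- f ⊙ e is the composite f ∘ e; read as a subset, it is the image of e under f.
_⊙_ : ∀ {k m n} → Embedding m n → Embedding k m → Embedding k n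
done   ⊙ e      = e
skip f ⊙ e      = skip (f ⊙ e)
keep f ⊙ skip e = skip (f ⊙ e)
keep f ⊙ keep e = keep (f ⊙ e)

_≟ᴱ_ : ∀ {k n} → DecidableEquality (Embedding k n)
done   ≟ᴱ done   = yes refl
skip f ≟ᴱ keep g = no λ ()
keep f ≟ᴱ skip g = no λ ()
skip f ≟ᴱ skip g with f ≟ᴱ g
... | yes refl = yes refl
... | no  f≢g  = no λ { refl → f≢g refl }
keep f ≟ᴱ keep g with f ≟ᴱ g
... | yes refl = yes refl
... | no  f≢g  = no λ { refl → f≢g refl }

-- Every embedding, exactly once.
embeddings : ∀ k n → List (Embedding k n)
embeddings zero    zero    = done ∷ []
embeddings (suc k) zero    = []
embeddings zero    (suc n) = map skip (embeddings zero n)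
embeddings (suc k) (suc n) = map keep (embeddings k n) ++ map skip (embeddings (suc k) n)

------------------------------------------------------------------------
-- Ordered r-uniform hypergraphs on {0 < … < order - 1}.

record OrderedHypergraph (r : ℕ) : Set₁ where
  field
    order : ℕ
    Edge  : Pred (Embedding r order) 0ℓ
    edge? : Decidable Edge

  edges : List (Embedding r order)
  edges = filter edge? (embeddings r order)

open OrderedHypergraph public

-- Vertices and starting positions are numbered from 0.
P : (r s : ℕ) → OrderedHypergraph r
P r s = record
  { order = s
  ; Edge  = λ e → ∃ λ (j : Fin (suc s ∸ r)) → ∀ i → toℕ (e ⟨$⟩ i) ≡ toℕ j ℕ.+ toℕ i
  ; edge? = λ e → any? λ j → all? λ i → toℕ (e ⟨$⟩ i) ℕ.≟ toℕ j ℕ.+ toℕ i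
  }

-- E(K_n^(r)).
KEdge : (r n : ℕ) → Set
KEdge r n = Embedding r n

module _ {r : ℕ} (n : ℕ) (H : OrderedHypergraph r) where

  -- A copy of H, as a subgraph of K_n^(r), is determined by its vertex set,
  -- hence by the order-preserving injection of which it is the image.
  Copy : Set
  Copy = Embedding (order H) n

  copies : List Copy
  copies = embeddings (order H) n

  copyEdges : Copy → List (KEdge r n)
  copyEdges f = map (f ⊙_) (edges H)

  copiesContaining : KEdge r n → List Copy
  copiesContaining e = filter (λ f → mem? _≟ᴱ_ e (copyEdges f)) copies

  EdgeDisjoint : Rel Copy 0ℓ
  EdgeDisjoint f g = Disjoint (copyEdges f) (copyEdges g)

  -- A set of copies, listed without repetition.
  IsPacking : Pred (List Copy) 0ℓ
  IsPacking = AllPairs (λ f g → f ≢ g × EdgeDisjoint f g)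

  IsFractionalPacking : Pred (Copy → ℝ) 0ℓ
  IsFractionalPacking w =
    (∀ f → 0ℝ ≤ℝ w f) × (∀ e → sumOver (copiesContaining e) w ≤ℝ 1ℝ)

  IsFractionalTransversal : Pred (KEdge r n → ℝ) 0ℓ
  IsFractionalTransversal w =
    (∀ e → 0ℝ ≤ℝ w e) × (∀ f → 1ℝ ≤ℝ sumOver (copyEdges f) w)

IsMaximum : {A : Set} → Rel A 0ℓ → Pred A 0ℓ → Pred A 0ℓ
IsMaximum _≤_ S v = S v × (∀ u → S u → u ≤ v)

IsMinimum : {A : Set} → Rel A 0ℓ → Pred A 0ℓ → Pred A 0ℓ
IsMinimum _≤_ = IsMaximum (flip _≤_)

module _ {r : ℕ} (n : ℕ) (H : OrderedHypergraph r) where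

  -- "k = ν(n,H)"
  Isν : Pred ℕ 0ℓ
  Isν = IsMaximum ℕ._≤_ λ k → ∃ λ p → IsPacking n H p × length p ≡ k

  -- "x = ν*(n,H)"
  Isν* : Pred ℝ 0ℓ
  Isν* = IsMaximum _≤ℝ_ λ x →
    ∃ λ w → IsFractionalPacking n H w × sumOver (copies n H) w ≃ x

  -- "x = τ*(n,H)"
  Isτ* : Pred ℝ 0ℓ
  Isτ* = IsMinimum _≤ℝ_ λ x →
    ∃ λ w → IsFractionalTransversal n H w × sumOver (embeddings r n) w ≃ x

-- a n = (c + o(1)) · binom(n, r) as n → ∞.
_≈[_+o1]binom_ : (ℕ → ℝ) → ℚ → ℕ → Set
a ≈[ c +o1]binom r = ∀ ε → 0ℚ ℚ.< ε → ∃ λ N → ∀ n → N ℕ.≤ n →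
  fromℚ ((c ℚ.- ε) ℚ.* (+ (n C r) / 1)) ≤ℝ a n ×
  a n ≤ℝ fromℚ ((c ℚ.+ ε) ℚ.* (+ (n C r) / 1))

{-# OPTIONS --safe #-}

-- Write s = t r.  For the upper bound, cut [n] into t intervals of length m ≥ n/t and give
-- weight 1/t to the r-sets inside an interval: at most (t - 1)(r - 1) of the windows of a
-- copy cross a boundary, so at least t lie inside an interval, and the total weight is at
-- most binom(m, r).  For the lower bound, send an r-set x ⊆ [m], with t m ≤ n, to the copy
-- formed by the translates x, x + m, …, x + (t - 1)m: the vertices of each of its edges,
-- reduced modulo m, are exactly x, so copies from distinct x share no edge.  Taking m next
-- to n/t, both bounds are (t^(-r) + o(1)) binom(n, r).  Rational Farkas duality provides
-- optimal fractional packings and transversals of equal rational value, and weak duality,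
-- applied to the terms of Cauchy sequences up to a vanishing error, shows that they are
-- also optimal among real weights.
module Submission where

open import Defs
import Algebra.Definitions.RawSemiring as RawSemiring
open import Data.Bool using (Bool; true; false; if_then_else_; T?)
open import Data.Fin using (zero; suc; toℕ; fromℕ<)
import Data.Fin.Properties as Finₚ
open import Data.Integer as ℤ using ()
import Data.Integer.Properties as ℤₚ
open import Data.List using (List; []; _∷_; _++_; map; filter; foldr; length; concat; cartesianProductWith; applyDownFrom; downFrom)
import Data.List.Membership.DecPropositional as DecMembership
open import Data.List.Membership.Propositional using (_∈_; _∉_; find; lose)
open import Data.List.Membership.Propositional.Properties
open import Data.List.Membership.Propositional.Properties.WithK using (unique∧set⇒bag)
open import Data.List.Properties using (length-map; length-++; length-downFrom)
open import Data.List.Relation.Binary.BagAndSetEquality using (∼bag⇒↭)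
open import Data.List.Relation.Binary.Disjoint.Propositional using (Disjoint)
open import Data.List.Relation.Binary.Permutation.Propositional as ↭ using (_↭_)
open import Data.List.Relation.Unary.All as All using (All; []; _∷_)
import Data.List.Relation.Unary.All.Properties as Allₚ
open import Data.List.Relation.Unary.AllPairs as AllPairs using ([]; _∷_)
import Data.List.Relation.Unary.AllPairs.Properties as AllPairsₚ
open import Data.List.Relation.Unary.Any using (here; there; any?)
open import Data.List.Relation.Unary.Unique.Propositional using (Unique)
import Data.List.Relation.Unary.Unique.Propositional.Properties as Uniqueₚ
open import Data.Nat as ℕ using (ℕ; zero; suc; NonZero; z≤n; s≤s; z<s; _!)
open import Data.Nat.Combinatorics using (_C_; nC1≡n; nCk+nC[k+1]≡[n+1]C[k+1])
open import Data.Nat.Divisibility using (_∣_; divides)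
open import Data.Nat.DivMod hiding (_/_)
import Data.Nat.Properties as ℕₚ
import Data.Nat.Solver as ℕSolver
open import Data.Product using (∃; _×_; _,_; proj₁; proj₂)
open import Data.Rational as ℚ using (ℚ; 0ℚ; 1ℚ)
import Data.Rational.Properties as ℚₚ
import Data.Rational.Solver as ℚSolver
open import Data.Rational.Unnormalised as ℚᵘ using (mkℚᵘ)
import Data.Rational.Unnormalised.Properties as ℚᵘₚ
open import Data.Sum using (_⊎_; inj₁; inj₂)
import Data.Sum.Properties as Sumₚ
open import Function using (_∘_; const; mk⇔)
open import Relation.Binary using (DecidableEquality; tri<; tri≈; tri>)
open import Relation.Binary.PropositionalEquality using (_≡_; _≢_; refl; sym; trans; cong; cong₂; subst; subst₂; module ≡-Reasoning)
open import Relation.Nullary using (¬_; Dec; yes; no; does; contradiction)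
open import Relation.Nullary.Decidable using (map′; ¬?; _×-dec_)
open import Relation.Unary using (Decidable)

-- The three quantities are squeezed together: ν ≤ ν* = τ*, so one packing and one transversal
-- settle all of them. Divisibility makes the two ends meet: r consecutive vertices of a path on t r
-- vertices run through all residues modulo r, and its (t - 1)r + 1 windows are exactly t more than
-- the boundaries can spoil. The theorem also asserts that the extrema are attained. For ν a finite
-- search suffices. For ν* and τ* the obstacle is that the order of Cauchy reals cannot be decided,
-- so no elimination can branch on the sign of a real coefficient. Both programs have coefficients 0
-- and 1, so they are solved over ℚ, where signs are decidable. A real competitor satisfies its
-- constraints, at a late stage of its sequences, only up to some η; adding η to every weight
-- repairs the signs, at a cost proportional to η because the programs are finite.

module _ where

  open import Data.Rational using (_+_; _*_; _-_; -_; _≤_; _<_)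
  open ℚSolver.+-*-Solver using (solve; _:+_; _:*_; _:-_; :-_; _:=_; con)

  -- Rational inequalities and finite sums

  0≤q-p⇒p≤q : ∀ {p q} → 0ℚ ≤ q - p → p ≤ q
  0≤q-p⇒p≤q {p} {q} h = begin
    p            ≡⟨ ℚₚ.+-identityˡ p ⟨
    0ℚ + p       ≤⟨ ℚₚ.+-monoˡ-≤ p h ⟩
    (q - p) + p  ≡⟨ solve 2 (λ p q → (q :- p) :+ p := q) refl p q ⟩
    q            ∎
    where open ℚₚ.≤-Reasoning

  p≤q⇒0≤q-p : ∀ {p q} → p ≤ q → 0ℚ ≤ q - p
  p≤q⇒0≤q-p {p} {q} h = subst (_≤ q - p) (ℚₚ.+-inverseʳ p) (ℚₚ.+-monoˡ-≤ (- p) h)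

  *-nonNeg : ∀ {p q} → 0ℚ ≤ p → 0ℚ ≤ q → 0ℚ ≤ p * q
  *-nonNeg {p} {q} 0≤p 0≤q = ℚₚ.nonNegative⁻¹ (p * q)
    {{ℚₚ.nonNeg*nonNeg⇒nonNeg p {{ℚ.nonNegative 0≤p}} q {{ℚ.nonNegative 0≤q}}}}

  +-nonNeg : ∀ {p q} → 0ℚ ≤ p → 0ℚ ≤ q → 0ℚ ≤ p + q
  +-nonNeg = ℚₚ.+-mono-≤

  *-monoˡ : ∀ {p q r} → 0ℚ ≤ r → p ≤ q → r * p ≤ r * q
  *-monoˡ {r = r} 0≤r = ℚₚ.*-monoˡ-≤-nonNeg r {{ℚ.nonNegative 0≤r}}

  *-monoʳ : ∀ {p q r} → 0ℚ ≤ r → p ≤ q → p * r ≤ q * r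
  *-monoʳ {r = r} 0≤r = ℚₚ.*-monoʳ-≤-nonNeg r {{ℚ.nonNegative 0≤r}}

  𝟙 : {P : Set} → Dec P → ℚ
  𝟙 d = if does d then 1ℚ else 0ℚ

  𝟙-nonNeg : {P : Set} (d : Dec P) → 0ℚ ≤ 𝟙 d
  𝟙-nonNeg (yes _) = ℚₚ.nonNegative⁻¹ 1ℚ
  𝟙-nonNeg (no _)  = ℚₚ.≤-refl

  𝟙≤1 : {P : Set} (d : Dec P) → 𝟙 d ≤ 1ℚ
  𝟙≤1 (yes _) = ℚₚ.≤-refl
  𝟙≤1 (no _)  = ℚₚ.nonNegative⁻¹ 1ℚ

  ∑ : {A : Set} → List A → (A → ℚ) → ℚ
  ∑ xs f = foldr (λ a t → f a + t) 0ℚ xs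

  module _ {A : Set} where

    ∑-cong : ∀ xs {f g : A → ℚ} → (∀ {a} → a ∈ xs → f a ≡ g a) → ∑ xs f ≡ ∑ xs g
    ∑-cong []       h = refl
    ∑-cong (x ∷ xs) h = cong₂ _+_ (h (here refl)) (∑-cong xs (h ∘ there))

    ∑-mono : ∀ xs {f g : A → ℚ} → (∀ {a} → a ∈ xs → f a ≤ g a) → ∑ xs f ≤ ∑ xs g
    ∑-mono []       h = ℚₚ.≤-refl
    ∑-mono (x ∷ xs) h = ℚₚ.+-mono-≤ (h (here refl)) (∑-mono xs (h ∘ there))

    ∑-0 : ∀ (xs : List A) → ∑ xs (const 0ℚ) ≡ 0ℚ
    ∑-0 []       = refl
    ∑-0 (x ∷ xs) = trans (ℚₚ.+-identityˡ _) (∑-0 xs)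

    ∑-nonNeg : ∀ xs {f : A → ℚ} → (∀ a → 0ℚ ≤ f a) → 0ℚ ≤ ∑ xs f
    ∑-nonNeg xs {f} h = subst (_≤ ∑ xs f) (∑-0 xs) (∑-mono xs λ {a} _ → h a)

    ∑-+ : ∀ xs (f g : A → ℚ) → ∑ xs (λ a → f a + g a) ≡ ∑ xs f + ∑ xs g
    ∑-+ []       f g = refl
    ∑-+ (x ∷ xs) f g = trans (cong (f x + g x +_) (∑-+ xs f g))
      (solve 4 (λ a b c d → (a :+ b) :+ (c :+ d) := (a :+ c) :+ (b :+ d)) refl (f x) (g x) _ _)

    ∑-*ˡ : ∀ xs c (f : A → ℚ) → ∑ xs (λ a → c * f a) ≡ c * ∑ xs f
    ∑-*ˡ []       c f = sym (ℚₚ.*-zeroʳ c)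
    ∑-*ˡ (x ∷ xs) c f = trans (cong (c * f x +_) (∑-*ˡ xs c f)) (sym (ℚₚ.*-distribˡ-+ c _ _))

    ∑-neg : ∀ xs (f : A → ℚ) → ∑ xs (λ a → - f a) ≡ - ∑ xs f
    ∑-neg []       f = refl
    ∑-neg (x ∷ xs) f = trans (cong (- f x +_) (∑-neg xs f)) (sym (ℚₚ.neg-distrib-+ (f x) _))

    ∑-++ : ∀ xs ys (f : A → ℚ) → ∑ (xs ++ ys) f ≡ ∑ xs f + ∑ ys f
    ∑-++ []       ys f = sym (ℚₚ.+-identityˡ _)
    ∑-++ (x ∷ xs) ys f = trans (cong (f x +_) (∑-++ xs ys f)) (sym (ℚₚ.+-assoc (f x) _ _))

    ∑-↭ : ∀ {xs ys} (f : A → ℚ) → xs ↭ ys → ∑ xs f ≡ ∑ ys f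
    ∑-↭ f ↭.refl          = refl
    ∑-↭ f (↭.prep x p)    = cong (f x +_) (∑-↭ f p)
    ∑-↭ f (↭.swap x y p)  = trans (cong (λ t → f x + (f y + t)) (∑-↭ f p))
      (solve 3 (λ a b c → a :+ (b :+ c) := b :+ (a :+ c)) refl (f x) (f y) _)
    ∑-↭ f (↭.trans p q)   = trans (∑-↭ f p) (∑-↭ f q)

    ∑-filter : ∀ {P : A → Set} (P? : Decidable P) xs (f : A → ℚ) →
               ∑ (filter P? xs) f ≡ ∑ xs (λ a → 𝟙 (P? a) * f a)
    ∑-filter P? []       f = refl
    ∑-filter P? (x ∷ xs) f with does (P? x)
    ... | true  = cong₂ _+_ (sym (ℚₚ.*-identityˡ (f x))) (∑-filter P? xs f)
    ... | false = trans (∑-filter P? xs f)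
                  (sym (trans (cong (_+ _) (ℚₚ.*-zeroˡ (f x))) (ℚₚ.+-identityˡ _)))

  ∑-map : ∀ {A B : Set} (h : A → B) xs (f : B → ℚ) → ∑ (map h xs) f ≡ ∑ xs (f ∘ h)
  ∑-map h []       f = refl
  ∑-map h (x ∷ xs) f = cong (f (h x) +_) (∑-map h xs f)

  ∑-swap : ∀ {A B : Set} (xs : List A) (ys : List B) (f : A → B → ℚ) →
           ∑ xs (λ a → ∑ ys (f a)) ≡ ∑ ys (λ b → ∑ xs (λ a → f a b))
  ∑-swap []       ys f = sym (∑-0 ys)
  ∑-swap (x ∷ xs) ys f = trans (cong (∑ ys (f x) +_) (∑-swap xs ys f)) (sym (∑-+ ys (f x) _))

  module _ {A : Set} (_≟_ : DecidableEquality A) where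

    open DecMembership _≟_ using (_∈?_)

    -- Filtering `ys` by membership in `xs` gives a duplicate-free list with the same members as
    -- `xs`, hence a permutation of it. This turns a sum over the edges of one copy into a sum over
    -- all edges weighted by incidence, the form that duality needs.
    ∑-restrict : ∀ {xs ys} → Unique xs → Unique ys → (∀ {a} → a ∈ xs → a ∈ ys) → (f : A → ℚ) →
                 ∑ xs f ≡ ∑ ys (λ a → 𝟙 (a ∈? xs) * f a)
    ∑-restrict {xs} {ys} xs! ys! xs⊆ys f = trans
      (∑-↭ f (∼bag⇒↭ (unique∧set⇒bag xs! (Uniqueₚ.filter⁺ (_∈? xs) ys!)
        (mk⇔ (λ a∈xs → ∈-filter⁺ (_∈? xs) (xs⊆ys a∈xs) a∈xs)
             (λ a∈ → proj₂ (∈-filter⁻ (_∈? xs) {xs = ys} a∈))))))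
      (∑-filter (_∈? xs) ys f)

    ∑-⊆ : ∀ {xs ys} → Unique xs → Unique ys → (∀ {a} → a ∈ xs → a ∈ ys) →
          {f : A → ℚ} → (∀ a → 0ℚ ≤ f a) → ∑ xs f ≤ ∑ ys f
    ∑-⊆ {xs} {ys} xs! ys! xs⊆ys {f} 0≤f = ℚₚ.≤-trans
      (ℚₚ.≤-reflexive (∑-restrict xs! ys! xs⊆ys f))
      (∑-mono ys λ {a} _ → subst (𝟙 (a ∈? xs) * f a ≤_) (ℚₚ.*-identityˡ (f a)) (*-monoʳ (0≤f a) (𝟙≤1 (a ∈? xs))))

    δ : A → A → ℚ
    δ a b = 𝟙 (a ≟ b)

    ∑-δ-∉ : ∀ {a xs} (f : A → ℚ) → a ∉ xs → ∑ xs (λ b → f b * δ a b) ≡ 0ℚ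
    ∑-δ-∉ {a} {xs} f a∉ = trans (∑-cong xs vanish) (∑-0 xs)
      where
      vanish : ∀ {b} → b ∈ xs → f b * δ a b ≡ 0ℚ
      vanish {b} b∈ with a ≟ b
      ... | yes refl = contradiction b∈ a∉
      ... | no  _    = ℚₚ.*-zeroʳ (f b)

    ∑-δ : ∀ {a xs} (f : A → ℚ) → Unique xs → a ∈ xs → ∑ xs (λ b → f b * δ a b) ≡ f a
    ∑-δ {a} {x ∷ xs} f xs!@(_ ∷ xs!′) a∈ with a ≟ x
    ... | yes refl = trans (cong₂ _+_ (ℚₚ.*-identityʳ (f a))
                             (∑-δ-∉ f (Uniqueₚ.Unique[x∷xs]⇒x∉xs xs!)))
                           (ℚₚ.+-identityʳ (f a))
    ... | no a≢x with a∈
    ...   | here a≡x   = contradiction a≡x a≢x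
    ...   | there a∈xs = trans (cong₂ _+_ (ℚₚ.*-zeroʳ (f x)) (∑-δ f xs!′ a∈xs)) (ℚₚ.+-identityˡ (f a))

  -- Systems of linear inequalities and Farkas' lemma

  separate : ∀ (ls us : List ℚ) → (∀ {l u} → l ∈ ls → u ∈ us → l ≤ u) →
             ∃ λ z → (∀ {l} → l ∈ ls → l ≤ z) × (∀ {u} → u ∈ us → z ≤ u)
  separate [] []       _ = 0ℚ , (λ ()) , λ ()
  separate [] (u ∷ us) _ with separate [] us (λ ())
  ... | z , _ , z≤ = u ℚ.⊓ z , (λ ()) , λ where
    (here refl) → ℚₚ.p⊓q≤p u z
    (there u∈)  → ℚₚ.≤-trans (ℚₚ.p⊓q≤q u z) (z≤ u∈)
  -- Raising the value to `l` keeps it under every `u`, because `l` itself is under every `u`. The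
  -- starting value is the minimum of 0 and all upper bounds.
  separate (l ∷ ls) us h with separate ls us (h ∘ there)
  ... | z , ≤z , z≤ = l ℚ.⊔ z
    , (λ where (here refl) → ℚₚ.p≤p⊔q l z
               (there l∈)  → ℚₚ.≤-trans (≤z l∈) (ℚₚ.p≤q⊔p l z))
    , λ u∈ → ℚₚ.⊔-lub (h (here refl) u∈) (z≤ u∈)

  module _ {X : Set} where

    record Inequality : Set where
      constructor _≼_
      field
        lhs : X → ℚ
        rhs : ℚ

    open Inequality public

    infixl 6 _⊕_
    infixr 7 _⊛_

    _⊕_ : Inequality → Inequality → Inequality
    i ⊕ j = (λ v → lhs i v + lhs j v) ≼ (rhs i + rhs j)

    _⊛_ : ℚ → Inequality → Inequality
    c ⊛ i = (λ v → c * lhs i v) ≼ (c * rhs i)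

    eval : List X → (X → ℚ) → Inequality → ℚ
    eval vs x i = ∑ vs (λ v → lhs i v * x v)

    Satisfies : List X → (X → ℚ) → Inequality → Set
    Satisfies vs x i = eval vs x i ≤ rhs i

    -- Combinations are kept as derivation trees, so that multipliers can later be computed by
    -- recursion on them, with no bookkeeping of indices during the elimination.
    data Cone (S : List Inequality) : Inequality → Set where
      generator : ∀ {i} → i ∈ S → Cone S i
      add       : ∀ {i j} → Cone S i → Cone S j → Cone S (i ⊕ j)
      scale     : ∀ {i} c → 0ℚ ≤ c → Cone S i → Cone S (c ⊛ i)

    Cone-bind : ∀ {S T} → (∀ {i} → i ∈ S → Cone T i) → ∀ {i} → Cone S i → Cone T i
    Cone-bind h (generator i∈)   = h i∈
    Cone-bind h (add p q)        = add (Cone-bind h p) (Cone-bind h q)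
    Cone-bind h (scale c 0≤c p)  = scale c 0≤c (Cone-bind h p)

    Cone-lhs≡0 : ∀ {S v} → (∀ {i} → i ∈ S → lhs i v ≡ 0ℚ) → ∀ {i} → Cone S i → lhs i v ≡ 0ℚ
    Cone-lhs≡0 h (generator i∈)  = h i∈
    Cone-lhs≡0 h (add p q)       = cong₂ _+_ (Cone-lhs≡0 h p) (Cone-lhs≡0 h q)
    Cone-lhs≡0 h (scale c _ p)   = trans (cong (c *_) (Cone-lhs≡0 h p)) (ℚₚ.*-zeroʳ c)

    eval-⊕ : ∀ vs x i j → eval vs x (i ⊕ j) ≡ eval vs x i + eval vs x j
    eval-⊕ vs x i j = trans (∑-cong vs λ {v} _ → ℚₚ.*-distribʳ-+ (x v) (lhs i v) (lhs j v))
      (∑-+ vs (λ v → lhs i v * x v) (λ v → lhs j v * x v))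

    eval-⊛ : ∀ vs x c i → eval vs x (c ⊛ i) ≡ c * eval vs x i
    eval-⊛ vs x c i = trans (∑-cong vs λ {v} _ → ℚₚ.*-assoc c (lhs i v) (x v)) (∑-*ˡ vs c _)

    Satisfies-⊛⁻ : ∀ vs x i c .{{_ : ℚ.Positive c}} → Satisfies vs x (c ⊛ i) → Satisfies vs x i
    Satisfies-⊛⁻ vs x i c h = ℚₚ.*-cancelˡ-≤-pos c (subst (_≤ c * rhs i) (eval-⊛ vs x c i) h)

    -- Each inequality is divided by the absolute value of its coefficient at `v`, unless that is 0,
    -- so that it bounds `v` from above, from below, or not at all. The fields `upper-ok`,
    -- `lower-ok` and `free-ok` carry certificates of infeasibility back to `S`, and `complete`
    -- carries solutions back.
    record Normalised (v : X) (S : List Inequality) : Set where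
      field
        upper lower free : List Inequality
        upper-ok : ∀ {i} → i ∈ upper → Cone S i × lhs i v ≡ 1ℚ
        lower-ok : ∀ {i} → i ∈ lower → Cone S i × lhs i v ≡ - 1ℚ
        free-ok  : ∀ {i} → i ∈ free  → Cone S i × lhs i v ≡ 0ℚ
        complete : ∀ vs x → (∀ {i} → i ∈ upper → Satisfies vs x i) →
                   (∀ {i} → i ∈ lower → Satisfies vs x i) →
                   (∀ {i} → i ∈ free → Satisfies vs x i) →
                   ∀ {i} → i ∈ S → Satisfies vs x i

    normalise : ∀ v S → Normalised v S
    normalise v [] = record
      { upper = [] ; lower = [] ; free = []
      ; upper-ok = λ () ; lower-ok = λ () ; free-ok = λ () ; complete = λ _ _ _ _ _ () }
    normalise v (i ∷ S) = go (ℚₚ.<-cmp (lhs i v) 0ℚ)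
      where
      open Normalised (normalise v S)

      weaken : ∀ {v c j} → Cone S j × lhs j v ≡ c → Cone (i ∷ S) j × lhs j v ≡ c
      weaken (p , eq) = Cone-bind (generator ∘ there) p , eq

      insert : ∀ {j T} {Q : Inequality → Set} → Q j → (∀ {k} → k ∈ T → Q k) → ∀ {k} → k ∈ j ∷ T → Q k
      insert q h (here refl) = q
      insert q h (there k∈)  = h k∈

      go : _ → Normalised v (i ∷ S)
      go (tri≈ _ lhs≡0 _) = record
        { upper = upper ; lower = lower ; free = i ∷ free
        ; upper-ok = weaken ∘ upper-ok ; lower-ok = weaken ∘ lower-ok
        ; free-ok  = insert (generator (here refl) , lhs≡0) (weaken ∘ free-ok)
        ; complete = λ vs x u l f → insert (f (here refl)) (complete vs x u l (f ∘ there)) }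
      go (tri> _ _ lhs>0) = record
        { upper = c ⊛ i ∷ upper ; lower = lower ; free = free
        ; upper-ok = insert (scale c (ℚₚ.<⇒≤ (ℚₚ.positive⁻¹ c {{c>0}})) (generator (here refl)) , ℚₚ.*-inverseˡ (lhs i v) {{nz}})
                            (weaken ∘ upper-ok)
        ; lower-ok = weaken ∘ lower-ok ; free-ok = weaken ∘ free-ok
        ; complete = λ vs x u l f → insert (Satisfies-⊛⁻ vs x i c {{c>0}} (u (here refl))) (complete vs x (u ∘ there) l f) }
        where
        pos : ℚ.Positive (lhs i v)
        pos = ℚ.positive lhs>0
        nz : ℚ.NonZero (lhs i v)
        nz = ℚₚ.pos⇒nonZero (lhs i v) {{pos}}
        c : ℚ
        c = (ℚ.1/ lhs i v) {{nz}}
        c>0 : ℚ.Positive c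
        c>0 = ℚₚ.1/pos⇒pos (lhs i v) {{pos}}
      go (tri< lhs<0 _ _) = record
        { upper = upper ; lower = c ⊛ i ∷ lower ; free = free
        ; upper-ok = weaken ∘ upper-ok
        ; lower-ok = insert (scale c (ℚₚ.<⇒≤ (ℚₚ.positive⁻¹ c {{c>0}})) (generator (here refl)) ,
                             trans (sym (ℚₚ.neg-distribˡ-* ((ℚ.1/ lhs i v) {{nz}}) (lhs i v))) (cong -_ (ℚₚ.*-inverseˡ (lhs i v) {{nz}})))
                            (weaken ∘ lower-ok)
        ; free-ok = weaken ∘ free-ok
        ; complete = λ vs x u l f → insert (Satisfies-⊛⁻ vs x i c {{c>0}} (l (here refl))) (complete vs x u (l ∘ there) f) }
        where
        neg : ℚ.Negative (lhs i v)
        neg = ℚ.negative lhs<0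
        nz : ℚ.NonZero (lhs i v)
        nz = ℚₚ.neg⇒nonZero (lhs i v) {{neg}}
        c : ℚ
        c = - (ℚ.1/ lhs i v) {{nz}}
        c>0 : ℚ.Positive c
        c>0 = ℚ.positive (ℚₚ.neg-antimono-< (ℚₚ.negative⁻¹ ((ℚ.1/ lhs i v) {{nz}}) {{ℚₚ.1/neg⇒neg (lhs i v) {{neg}}}}))

  Feasible : {X : Set} → List X → List (Inequality {X}) → Set
  Feasible vs S = ∃ λ x → ∀ {i} → i ∈ S → Satisfies vs x i

  Infeasible : {X : Set} → List X → List (Inequality {X}) → Set
  Infeasible vs S = ∃ λ i → Cone S i × (∀ {v} → v ∈ vs → lhs i v ≡ 0ℚ) × rhs i < 0ℚ

  -- Without variables every left-hand side is an empty sum, so an inequality holds exactly when its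
  -- right-hand side is nonnegative; one with a negative right-hand side is its own certificate.
  farkas-[] : {X : Set} (S : List (Inequality {X})) → Feasible [] S ⊎ Infeasible [] S
  farkas-[] [] = inj₁ ((λ _ → 0ℚ) , λ ())
  farkas-[] (i ∷ S) with ℚₚ._<?_ (rhs i) 0ℚ
  ... | yes rhs<0 = inj₂ (i , generator (here refl) , (λ ()) , rhs<0)
  ... | no  rhs≮0 with farkas-[] S
  ...   | inj₁ (x , sat) = inj₁ (x , λ where
            (here refl) → ℚₚ.≮⇒≥ rhs≮0
            (there i∈)  → sat i∈)
  ...   | inj₂ (j , p , z , neg) = inj₂ (j , Cone-bind (generator ∘ there) p , z , neg)

  -- Farkas' lemma, by Fourier–Motzkin elimination of the variables one at a time.
  farkas : {X : Set} → DecidableEquality X → (vs : List X) → Unique vs → ∀ S →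
           Feasible vs S ⊎ Infeasible vs S
  farkas _≟_ [] _ S = farkas-[] S
  farkas {X} _≟_ (v ∷ vs) vs!@(_ ∷ vs!′) S = go (farkas _≟_ vs vs!′ S′)
    where
    open Normalised (normalise v S)

    -- An upper and a lower inequality have coefficients 1 and -1 at `v`, so their plain sum is free
    -- of `v`.
    S′ : List Inequality
    S′ = free ++ cartesianProductWith _⊕_ upper lower

    S′-ok : ∀ {i} → i ∈ S′ → Cone S i × lhs i v ≡ 0ℚ
    S′-ok i∈ with ∈-++⁻ free i∈
    ... | inj₁ i∈free = free-ok i∈free
    ... | inj₂ i∈comb with ∈-cartesianProductWith⁻ _⊕_ upper lower i∈comb
    ...   | u , l , u∈ , l∈ , refl =
            add (proj₁ (upper-ok u∈)) (proj₁ (lower-ok l∈)) , cong₂ _+_ (proj₂ (upper-ok u∈)) (proj₂ (lower-ok l∈))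

    go : Feasible vs S′ ⊎ Infeasible vs S′ → Feasible (v ∷ vs) S ⊎ Infeasible (v ∷ vs) S
    -- Every member of `S′` has coefficient 0 at `v`, hence so has the certificate.
    go (inj₂ (i , p , z , neg)) = inj₂ (i , Cone-bind (proj₁ ∘ S′-ok) p ,
      (λ where (here refl) → Cone-lhs≡0 (proj₂ ∘ S′-ok) p
               (there w∈)  → z w∈) , neg)
    go (inj₁ (x , sat)) = inj₁ (x′ , complete (v ∷ vs) x′ upper-sat lower-sat free-sat)
      where
      lo hi : Inequality → ℚ
      lo i = eval vs x i - rhs i
      hi i = rhs i - eval vs x i

      -- A lower inequality asks the new coordinate to be at least `lo`, an upper one to be at most
      -- `hi`; the sums in `S′` say that all these bounds are compatible.
      gap : ∀ {p q} → p ∈ map lo lower → q ∈ map hi upper → p ≤ q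
      gap p∈ q∈ with ∈-map⁻ lo p∈ | ∈-map⁻ hi q∈
      ... | l , l∈ , refl | u , u∈ , refl = 0≤q-p⇒p≤q (subst (0ℚ ≤_)
            (trans (cong (_-_ (rhs (u ⊕ l))) (eval-⊕ vs x u l))
              (solve 4 (λ a b c d → (a :+ b) :- (c :+ d) := (a :- c) :- (d :- b)) refl (rhs u) (rhs l) (eval vs x u) (eval vs x l)))
            (p≤q⇒0≤q-p (sat (∈-++⁺ʳ free (∈-cartesianProductWith⁺ _⊕_ u∈ l∈)))))

      sep = separate (map lo lower) (map hi upper) gap
      z   = proj₁ sep

      x′ : X → ℚ
      x′ w = if does (w ≟ v) then z else x w

      x′-v : x′ v ≡ z
      x′-v with v ≟ v
      ... | yes _   = refl
      ... | no  v≢v = contradiction refl v≢v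

      x′-vs : ∀ {w} → w ∈ vs → x′ w ≡ x w
      x′-vs {w} w∈ with w ≟ v
      ... | yes refl = contradiction w∈ (Uniqueₚ.Unique[x∷xs]⇒x∉xs vs!)
      ... | no  _    = refl

      eval-x′ : ∀ {c i} → lhs i v ≡ c → eval (v ∷ vs) x′ i ≡ c * z + eval vs x i
      eval-x′ {i = i} eq = cong₂ _+_ (cong₂ _*_ eq x′-v) (∑-cong vs λ {w} w∈ → cong (lhs i w *_) (x′-vs w∈))

      upper-sat : ∀ {i} → i ∈ upper → Satisfies (v ∷ vs) x′ i
      upper-sat {i} i∈ = 0≤q-p⇒p≤q (subst (0ℚ ≤_)
        (sym (trans (cong (_-_ (rhs i)) (eval-x′ {i = i} (proj₂ (upper-ok i∈))))
          (solve 3 (λ b z e → b :- (con 1ℚ :* z :+ e) := (b :- e) :- z) refl (rhs i) z (eval vs x i))))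
        (p≤q⇒0≤q-p (proj₂ (proj₂ sep) (∈-map⁺ hi i∈))))

      lower-sat : ∀ {i} → i ∈ lower → Satisfies (v ∷ vs) x′ i
      lower-sat {i} i∈ = 0≤q-p⇒p≤q (subst (0ℚ ≤_)
        (sym (trans (cong (_-_ (rhs i)) (eval-x′ {i = i} (proj₂ (lower-ok i∈))))
          (solve 3 (λ b z e → b :- (:- con 1ℚ :* z :+ e) := z :- (e :- b)) refl (rhs i) z (eval vs x i))))
        (p≤q⇒0≤q-p (proj₁ (proj₂ sep) (∈-map⁺ lo i∈))))

      free-sat : ∀ {i} → i ∈ free → Satisfies (v ∷ vs) x′ i
      free-sat {i} i∈ = subst (_≤ rhs i)
        (sym (trans (eval-x′ {i = i} (proj₂ (free-ok i∈)))
          (solve 2 (λ z e → con 0ℚ :* z :+ e := e) refl z (eval vs x i))))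
        (sat (∈-++⁺ˡ i∈))

-- Linear programming duality

module Duality {A B : Set} (_≟ᴬ_ : DecidableEquality A) (_≟ᴮ_ : DecidableEquality B)
  (as : List A) (as! : Unique as) (∈as : ∀ a → a ∈ as)
  (bs : List B) (bs! : Unique bs) (∈bs : ∀ b → b ∈ bs)
  (M : B → A → ℚ) where

  open import Data.Rational using (_+_; _*_; _-_; -_; _≤_)
  open ℚSolver.+-*-Solver using (solve; _:+_; _:*_; _:-_; :-_; _:=_; con)

  load : (A → ℚ) → B → ℚ
  load x b = ∑ as (λ a → M b a * x a)

  cover : (B → ℚ) → A → ℚ
  cover y a = ∑ bs (λ b → M b a * y b)

  -- The sum of `M b a * x a * y b` over all pairs lies between the two sides. The constants α and β
  -- are free and of any sign, so that the inequality also serves for perturbed weights and for the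
  -- multipliers of a certificate, where the bound is μ or 0.
  weak-duality : ∀ {x y α β} → (∀ a → 0ℚ ≤ x a) → (∀ b → 0ℚ ≤ y b) →
                 (∀ b → load x b ≤ α) → (∀ a → β ≤ cover y a) →
                 β * ∑ as x ≤ α * ∑ bs y
  weak-duality {x} {y} {α} {β} 0≤x 0≤y load≤α β≤cover = begin
    β * ∑ as x
      ≡⟨ ∑-*ˡ as β x ⟨
    ∑ as (λ a → β * x a)
      ≤⟨ ∑-mono as (λ {a} _ → *-monoʳ (0≤x a) (β≤cover a)) ⟩
    ∑ as (λ a → cover y a * x a)
      ≡⟨ ∑-cong as (λ {a} _ → trans (ℚₚ.*-comm (cover y a) (x a)) (sym (∑-*ˡ bs (x a) _))) ⟩
    ∑ as (λ a → ∑ bs (λ b → x a * (M b a * y b)))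
      ≡⟨ ∑-swap as bs (λ a b → x a * (M b a * y b)) ⟩
    ∑ bs (λ b → ∑ as (λ a → x a * (M b a * y b)))
      ≡⟨ ∑-cong bs (λ {b} _ → trans (∑-cong as λ {a} _ →
           solve 3 (λ x m y → x :* (m :* y) := y :* (m :* x)) refl (x a) (M b a) (y b))
           (∑-*ˡ as (y b) (λ a → M b a * x a))) ⟩
    ∑ bs (λ b → y b * load x b)
      ≤⟨ ∑-mono bs (λ {b} _ → *-monoˡ (0≤y b) (load≤α b)) ⟩
    ∑ bs (λ b → y b * α)
      ≡⟨ ∑-cong bs (λ {b} _ → ℚₚ.*-comm (y b) α) ⟩
    ∑ bs (λ b → α * y b)
      ≡⟨ ∑-*ˡ bs α y ⟩
    α * ∑ bs y ∎
    where open ℚₚ.≤-Reasoning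

  -- Primal and dual feasibility together with "dual value ≤ primal value", as one system.
  capacityᴵ : B → Inequality {A ⊎ B}
  capacityᴵ b = (λ { (inj₁ a) → M b a ; (inj₂ _) → 0ℚ }) ≼ 1ℚ

  coverᴵ : A → Inequality {A ⊎ B}
  coverᴵ a = (λ { (inj₁ _) → 0ℚ ; (inj₂ b) → - M b a }) ≼ (- 1ℚ)

  nonNegᴬ : A → Inequality {A ⊎ B}
  nonNegᴬ a = (λ { (inj₁ a′) → - δ _≟ᴬ_ a a′ ; (inj₂ _) → 0ℚ }) ≼ 0ℚ

  nonNegᴮ : B → Inequality {A ⊎ B}
  nonNegᴮ b = (λ { (inj₁ _) → 0ℚ ; (inj₂ b′) → - δ _≟ᴮ_ b b′ }) ≼ 0ℚ

  valueᴵ : Inequality {A ⊎ B}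
  valueᴵ = (λ { (inj₁ _) → - 1ℚ ; (inj₂ _) → 1ℚ }) ≼ 0ℚ

  variables : List (A ⊎ B)
  variables = map inj₁ as ++ map inj₂ bs

  system : List (Inequality {A ⊎ B})
  system = map capacityᴵ bs ++ map coverᴵ as ++ map nonNegᴬ as ++ map nonNegᴮ bs ++ (valueᴵ ∷ [])

  variables! : Unique variables
  variables! = Uniqueₚ.++⁺ (Uniqueₚ.map⁺ Sumₚ.inj₁-injective as!) (Uniqueₚ.map⁺ Sumₚ.inj₂-injective bs!) disjoint
    where
    disjoint : ∀ {v} → ¬ (v ∈ map inj₁ as × v ∈ map inj₂ bs)
    disjoint (p , q) with ∈-map⁻ inj₁ p | ∈-map⁻ inj₂ q
    ... | _ , _ , refl | _ , _ , ()

  eval-variables : ∀ z i → eval variables z i ≡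
    ∑ as (λ a → lhs i (inj₁ a) * z (inj₁ a)) + ∑ bs (λ b → lhs i (inj₂ b) * z (inj₂ b))
  eval-variables z i = trans (∑-++ (map inj₁ as) (map inj₂ bs) term)
    (cong₂ _+_ (∑-map inj₁ as term) (∑-map inj₂ bs term))
    where
    term : A ⊎ B → ℚ
    term v = lhs i v * z v

  -- Every consequence of the system is a combination with multipliers u, v, μ for the capacity,
  -- cover and value constraints, up to the sign constraints, which only lower the left-hand side.
  record Multipliers (i : Inequality {A ⊎ B}) : Set where
    field
      u : B → ℚ
      v : A → ℚ
      μ : ℚ
      0≤u : ∀ b → 0ℚ ≤ u b
      0≤v : ∀ a → 0ℚ ≤ v a
      0≤μ : 0ℚ ≤ μ
      lhs₁ : ∀ a → lhs i (inj₁ a) ≤ cover u a - μ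
      lhs₂ : ∀ b → lhs i (inj₂ b) ≤ μ - load v b
      value : ∑ bs u - ∑ as v ≤ rhs i

  multipliers-⊕ : ∀ {i j} → Multipliers i → Multipliers j → Multipliers (i ⊕ j)
  multipliers-⊕ {i} {j} p q = record
    { u = λ b → P.u b + Q.u b
    ; v = λ a → P.v a + Q.v a
    ; μ = P.μ + Q.μ
    ; 0≤u = λ b → +-nonNeg (P.0≤u b) (Q.0≤u b)
    ; 0≤v = λ a → +-nonNeg (P.0≤v a) (Q.0≤v a)
    ; 0≤μ = +-nonNeg P.0≤μ Q.0≤μ
    ; lhs₁ = λ a → ℚₚ.≤-trans (ℚₚ.+-mono-≤ (P.lhs₁ a) (Q.lhs₁ a)) (ℚₚ.≤-reflexive
        (trans (shuffle (cover P.u a) P.μ (cover Q.u a) Q.μ) (cong (_- (P.μ + Q.μ)) (sym (additive bs (λ b → M b a) P.u Q.u)))))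
    ; lhs₂ = λ b → ℚₚ.≤-trans (ℚₚ.+-mono-≤ (P.lhs₂ b) (Q.lhs₂ b)) (ℚₚ.≤-reflexive
        (trans (shuffle P.μ (load P.v b) Q.μ (load Q.v b)) (cong (_-_ (P.μ + Q.μ)) (sym (additive as (M b) P.v Q.v)))))
    ; value = ℚₚ.≤-trans (ℚₚ.≤-reflexive
        (trans (cong₂ _-_ (∑-+ bs P.u Q.u) (∑-+ as P.v Q.v)) (sym (shuffle (∑ bs P.u) (∑ as P.v) (∑ bs Q.u) (∑ as Q.v)))))
        (ℚₚ.+-mono-≤ P.value Q.value) }
    where
    module P = Multipliers p
    module Q = Multipliers q
    shuffle : ∀ a b c d → (a - b) + (c - d) ≡ (a + c) - (b + d)
    shuffle = solve 4 (λ a b c d → (a :- b) :+ (c :- d) := (a :+ c) :- (b :+ d)) refl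
    additive : ∀ {C : Set} (cs : List C) (m f g : C → ℚ) →
      ∑ cs (λ c → m c * (f c + g c)) ≡ ∑ cs (λ c → m c * f c) + ∑ cs (λ c → m c * g c)
    additive cs m f g = trans (∑-cong cs λ {c} _ → ℚₚ.*-distribˡ-+ (m c) (f c) (g c))
      (∑-+ cs (λ c → m c * f c) (λ c → m c * g c))

  multipliers-⊛ : ∀ {i} c → 0ℚ ≤ c → Multipliers i → Multipliers (c ⊛ i)
  multipliers-⊛ {i} c 0≤c p = record
    { u = λ b → c * u b
    ; v = λ a → c * v a
    ; μ = c * μ
    ; 0≤u = λ b → *-nonNeg 0≤c (0≤u b)
    ; 0≤v = λ a → *-nonNeg 0≤c (0≤v a)
    ; 0≤μ = *-nonNeg 0≤c 0≤μ
    ; lhs₁ = λ a → ℚₚ.≤-trans (*-monoˡ 0≤c (lhs₁ a)) (ℚₚ.≤-reflexive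
        (trans (distrib _ _) (cong (_- c * μ) (sym (homogeneous bs (λ b → M b a) u)))))
    ; lhs₂ = λ b → ℚₚ.≤-trans (*-monoˡ 0≤c (lhs₂ b)) (ℚₚ.≤-reflexive
        (trans (distrib _ _) (cong (_-_ (c * μ)) (sym (homogeneous as (M b) v)))))
    ; value = ℚₚ.≤-trans (ℚₚ.≤-reflexive
        (trans (cong₂ _-_ (∑-*ˡ bs c u) (∑-*ˡ as c v)) (sym (distrib _ _))))
        (*-monoˡ 0≤c value) }
    where
    open Multipliers p
    distrib : ∀ p q → c * (p - q) ≡ c * p - c * q
    distrib = solve 3 (λ c p q → c :* (p :- q) := c :* p :- c :* q) refl c
    homogeneous : ∀ {C : Set} (cs : List C) (m f : C → ℚ) →
      ∑ cs (λ d → m d * (c * f d)) ≡ c * ∑ cs (λ d → m d * f d)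
    homogeneous cs m f = trans
      (∑-cong cs λ {d} _ → solve 3 (λ m c f → m :* (c :* f) := c :* (m :* f)) refl (m d) c (f d))
      (∑-*ˡ cs c (λ d → m d * f d))

  ∑-*0 : ∀ {C : Set} (cs : List C) (m : C → ℚ) → ∑ cs (λ c → m c * 0ℚ) ≡ 0ℚ
  ∑-*0 cs m = trans (∑-cong cs λ {c} _ → ℚₚ.*-zeroʳ (m c)) (∑-0 cs)

  ∑-δ≡1 : ∀ {C : Set} (_≟_ : DecidableEquality C) {cs c} → Unique cs → c ∈ cs → ∑ cs (δ _≟_ c) ≡ 1ℚ
  ∑-δ≡1 _≟_ {cs} {c} cs! c∈ =
    trans (∑-cong cs λ {d} _ → sym (ℚₚ.*-identityˡ (δ _≟_ c d))) (∑-δ _≟_ (const 1ℚ) cs! c∈)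

  -δ≤0 : ∀ {C : Set} (_≟_ : DecidableEquality C) c d → - δ _≟_ c d ≤ 0ℚ
  -δ≤0 _≟_ c d = ℚₚ.neg-antimono-≤ (𝟙-nonNeg (c ≟ d))

  0≤0 : 0ℚ ≤ 0ℚ
  0≤0 = ℚₚ.≤-refl

  multipliers-capacity : ∀ b → Multipliers (capacityᴵ b)
  multipliers-capacity b = record
    { u = δ _≟ᴮ_ b ; v = const 0ℚ ; μ = 0ℚ
    ; 0≤u = λ b′ → 𝟙-nonNeg (b ≟ᴮ b′) ; 0≤v = λ _ → 0≤0 ; 0≤μ = 0≤0
    ; lhs₁ = λ a → ℚₚ.≤-reflexive (sym (trans (ℚₚ.+-identityʳ _) (∑-δ _≟ᴮ_ (λ b′ → M b′ a) bs! (∈bs b))))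
    ; lhs₂ = λ b′ → ℚₚ.≤-reflexive (sym (cong (_-_ 0ℚ) (∑-*0 as (M b′))))
    ; value = ℚₚ.≤-reflexive (cong₂ _-_ (∑-δ≡1 _≟ᴮ_ bs! (∈bs b)) (∑-0 as)) }

  multipliers-cover : ∀ a → Multipliers (coverᴵ a)
  multipliers-cover a = record
    { u = const 0ℚ ; v = δ _≟ᴬ_ a ; μ = 0ℚ
    ; 0≤u = λ _ → 0≤0 ; 0≤v = λ a′ → 𝟙-nonNeg (a ≟ᴬ a′) ; 0≤μ = 0≤0
    ; lhs₁ = λ a′ → ℚₚ.≤-reflexive (sym (cong (_- 0ℚ) (∑-*0 bs (λ b → M b a′))))
    ; lhs₂ = λ b → ℚₚ.≤-reflexive (sym (trans (cong (_-_ 0ℚ) (∑-δ _≟ᴬ_ (M b) as! (∈as a))) (ℚₚ.+-identityˡ (- M b a))))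
    ; value = ℚₚ.≤-reflexive (cong₂ _-_ (∑-0 bs) (∑-δ≡1 _≟ᴬ_ as! (∈as a))) }

  multipliers-nonPos : ∀ {i} → (∀ x → lhs i x ≤ 0ℚ) → rhs i ≡ 0ℚ → Multipliers i
  multipliers-nonPos {i} lhs≤0 rhs≡0 = record
    { u = const 0ℚ ; v = const 0ℚ ; μ = 0ℚ
    ; 0≤u = λ _ → 0≤0 ; 0≤v = λ _ → 0≤0 ; 0≤μ = 0≤0
    ; lhs₁ = λ a → ℚₚ.≤-trans (lhs≤0 (inj₁ a)) (ℚₚ.≤-reflexive (sym (cong (_- 0ℚ) (∑-*0 bs (λ b → M b a)))))
    ; lhs₂ = λ b → ℚₚ.≤-trans (lhs≤0 (inj₂ b)) (ℚₚ.≤-reflexive (sym (cong (_-_ 0ℚ) (∑-*0 as (M b)))))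
    ; value = ℚₚ.≤-reflexive (trans (cong₂ _-_ (∑-0 bs) (∑-0 as)) (sym rhs≡0)) }

  multipliers-value : Multipliers valueᴵ
  multipliers-value = record
    { u = const 0ℚ ; v = const 0ℚ ; μ = 1ℚ
    ; 0≤u = λ _ → 0≤0 ; 0≤v = λ _ → 0≤0 ; 0≤μ = ℚₚ.nonNegative⁻¹ 1ℚ
    ; lhs₁ = λ a → ℚₚ.≤-reflexive (sym (cong (_- 1ℚ) (∑-*0 bs (λ b → M b a))))
    ; lhs₂ = λ b → ℚₚ.≤-reflexive (sym (cong (_-_ 1ℚ) (∑-*0 as (M b))))
    ; value = ℚₚ.≤-reflexive (cong₂ _-_ (∑-0 bs) (∑-0 as)) }

  multipliers-system : All Multipliers system
  multipliers-system =
    Allₚ.++⁺ (Allₚ.map⁺ (All.universal multipliers-capacity bs))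
    (Allₚ.++⁺ (Allₚ.map⁺ (All.universal multipliers-cover as))
    (Allₚ.++⁺ (Allₚ.map⁺ (All.universal (λ a → multipliers-nonPos (λ { (inj₁ a′) → -δ≤0 _≟ᴬ_ a a′ ; (inj₂ _) → 0≤0 }) refl) as))
    (Allₚ.++⁺ (Allₚ.map⁺ (All.universal (λ b → multipliers-nonPos (λ { (inj₁ _) → 0≤0 ; (inj₂ b′) → -δ≤0 _≟ᴮ_ b b′ }) refl) bs))
    (multipliers-value ∷ []))))

  multipliers : ∀ {i} → Cone system i → Multipliers i
  multipliers (generator i∈)   = All.lookup multipliers-system i∈
  multipliers (add p q)        = multipliers-⊕ (multipliers p) (multipliers q)
  multipliers (scale c 0≤c p)  = multipliers-⊛ c 0≤c (multipliers p)

  -- In a certificate of infeasibility, `v` behaves as a packing and `u` as a transversal, both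
  -- scaled by μ, with ∑ u < ∑ v. If μ > 0, weak duality between them contradicts this. If μ = 0,
  -- every load of `v` is at most 0, and weak duality against the given `y₀` yields ∑ v ≤ 0 ≤ ∑ u.
  system-feasible : ∀ {y₀} → (∀ b → 0ℚ ≤ y₀ b) → (∀ a → 1ℚ ≤ cover y₀ a) → ¬ Infeasible variables system
  system-feasible {y₀} 0≤y₀ 1≤cover (i , p , lhs≡0 , rhs<0) = ℚₚ.<-irrefl refl (begin-strict
    0ℚ               ≤⟨ p≤q⇒0≤q-p ∑v≤∑u ⟩
    ∑ bs u - ∑ as v  ≤⟨ value ⟩
    rhs i            <⟨ rhs<0 ⟩
    0ℚ               ∎)
    where
    open ℚₚ.≤-Reasoning
    open Multipliers (multipliers p)

    μ≤cover : ∀ a → μ ≤ cover u a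
    μ≤cover a = 0≤q-p⇒p≤q (subst (_≤ cover u a - μ) (lhs≡0 (∈-++⁺ˡ (∈-map⁺ inj₁ (∈as a)))) (lhs₁ a))

    load≤μ : ∀ b → load v b ≤ μ
    load≤μ b = 0≤q-p⇒p≤q (subst (_≤ μ - load v b) (lhs≡0 (∈-++⁺ʳ (map inj₁ as) (∈-map⁺ inj₂ (∈bs b)))) (lhs₂ b))

    ∑v≤∑u : ∑ as v ≤ ∑ bs u
    ∑v≤∑u with ℚₚ.<-cmp 0ℚ μ
    ... | tri< 0<μ _ _ = ℚₚ.*-cancelˡ-≤-pos μ {{ℚ.positive 0<μ}} (weak-duality 0≤v 0≤u load≤μ μ≤cover)
    ... | tri> _ _ μ<0 = contradiction 0≤μ (λ h → ℚₚ.<-irrefl refl (ℚₚ.≤-<-trans h μ<0))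
    ... | tri≈ _ 0≡μ _ = begin
      ∑ as v        ≡⟨ ℚₚ.*-identityˡ _ ⟨
      1ℚ * ∑ as v   ≤⟨ weak-duality 0≤v 0≤y₀ (λ b → subst (load v b ≤_) (sym 0≡μ) (load≤μ b)) 1≤cover ⟩
      0ℚ * ∑ bs y₀  ≡⟨ ℚₚ.*-zeroˡ (∑ bs y₀) ⟩
      0ℚ            ≤⟨ ∑-nonNeg bs 0≤u ⟩
      ∑ bs u        ∎

  record Optimum : Set where
    field
      x : A → ℚ
      y : B → ℚ
      0≤x : ∀ a → 0ℚ ≤ x a
      0≤y : ∀ b → 0ℚ ≤ y b
      load≤1  : ∀ b → load x b ≤ 1ℚ
      1≤cover : ∀ a → 1ℚ ≤ cover y a
      values-agree : ∑ as x ≡ ∑ bs y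

  -- A solution of the system consists of feasible weights of both kinds with dual value at most the
  -- primal value; the reverse inequality is weak duality.
  strong-duality : ∀ {y₀} → (∀ b → 0ℚ ≤ y₀ b) → (∀ a → 1ℚ ≤ cover y₀ a) → Optimum
  strong-duality 0≤y₀ 1≤cover₀ with farkas (Sumₚ.≡-dec _≟ᴬ_ _≟ᴮ_) variables variables! system
  ... | inj₂ infeasible = contradiction infeasible (system-feasible 0≤y₀ 1≤cover₀)
  ... | inj₁ (z , sat) = record
    { x = x ; y = y ; 0≤x = 0≤x ; 0≤y = 0≤y ; load≤1 = load≤1 ; 1≤cover = 1≤cover
    ; values-agree = ℚₚ.≤-antisym ∑x≤∑y ∑y≤∑x }
    where
    x : A → ℚ
    x = z ∘ inj₁
    y : B → ℚ
    y = z ∘ inj₂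

    satisfied : All (Satisfies variables z) system
    satisfied = All.tabulate sat

    sat₁ = Allₚ.++⁻ (map capacityᴵ bs) satisfied
    sat₂ = Allₚ.++⁻ (map coverᴵ as) (proj₂ sat₁)
    sat₃ = Allₚ.++⁻ (map nonNegᴬ as) (proj₂ sat₂)
    sat₄ = Allₚ.++⁻ (map nonNegᴮ bs) (proj₂ sat₃)

    split : ∀ i {s t} → ∑ as (λ a → lhs i (inj₁ a) * x a) ≡ s → ∑ bs (λ b → lhs i (inj₂ b) * y b) ≡ t →
            Satisfies variables z i → s + t ≤ rhs i
    split i p q = subst (_≤ rhs i) (trans (eval-variables z i) (cong₂ _+_ p q))

    0*-vanishes : ∀ {C : Set} (cs : List C) (f : C → ℚ) → ∑ cs (λ c → 0ℚ * f c) ≡ 0ℚ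
    0*-vanishes cs f = trans (∑-*ˡ cs 0ℚ f) (ℚₚ.*-zeroˡ (∑ cs f))

    -*-∑ : ∀ {C : Set} (cs : List C) (m f : C → ℚ) → ∑ cs (λ c → - m c * f c) ≡ - ∑ cs (λ c → m c * f c)
    -*-∑ cs m f = trans (∑-cong cs λ {c} _ → sym (ℚₚ.neg-distribˡ-* (m c) (f c))) (∑-neg cs (λ c → m c * f c))

    -δ-∑ : ∀ {C : Set} (_≟_ : DecidableEquality C) {cs c} → Unique cs → c ∈ cs → (f : C → ℚ) →
           ∑ cs (λ d → - δ _≟_ c d * f d) ≡ - f c
    -δ-∑ _≟_ {cs} {c} cs! c∈ f = trans (-*-∑ cs (δ _≟_ c) f)
      (cong -_ (trans (∑-cong cs λ {d} _ → ℚₚ.*-comm (δ _≟_ c d) (f d)) (∑-δ _≟_ f cs! c∈)))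

    -p≤-q⇒q≤p : ∀ {p q} → - p ≤ - q → q ≤ p
    -p≤-q⇒q≤p {p} {q} h = 0≤q-p⇒p≤q (subst (0ℚ ≤_)
      (solve 2 (λ p q → :- q :- (:- p) := p :- q) refl p q) (p≤q⇒0≤q-p h))

    load≤1 : ∀ b → load x b ≤ 1ℚ
    load≤1 b = subst (_≤ 1ℚ) (ℚₚ.+-identityʳ (load x b))
      (split (capacityᴵ b) refl (0*-vanishes bs y) (All.lookup (Allₚ.map⁻ (proj₁ sat₁)) (∈bs b)))

    1≤cover : ∀ a → 1ℚ ≤ cover y a
    1≤cover a = -p≤-q⇒q≤p (subst (_≤ - 1ℚ) (ℚₚ.+-identityˡ (- cover y a))
      (split (coverᴵ a) (0*-vanishes as x) (-*-∑ bs (λ b → M b a) y) (All.lookup (Allₚ.map⁻ (proj₁ sat₂)) (∈as a))))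

    0≤x : ∀ a → 0ℚ ≤ x a
    0≤x a = -p≤-q⇒q≤p (subst (_≤ 0ℚ) (ℚₚ.+-identityʳ (- x a))
      (split (nonNegᴬ a) (-δ-∑ _≟ᴬ_ as! (∈as a) x) (0*-vanishes bs y) (All.lookup (Allₚ.map⁻ (proj₁ sat₃)) (∈as a))))

    0≤y : ∀ b → 0ℚ ≤ y b
    0≤y b = -p≤-q⇒q≤p (subst (_≤ 0ℚ) (ℚₚ.+-identityˡ (- y b))
      (split (nonNegᴮ b) (0*-vanishes as x) (-δ-∑ _≟ᴮ_ bs! (∈bs b) y) (All.lookup (Allₚ.map⁻ (proj₁ sat₄)) (∈bs b))))

    ∑y≤∑x : ∑ bs y ≤ ∑ as x
    ∑y≤∑x = 0≤q-p⇒p≤q (-p≤-q⇒q≤p (subst (_≤ 0ℚ)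
      (solve 2 (λ s t → :- con 1ℚ :* s :+ con 1ℚ :* t := :- (s :- t)) refl (∑ as x) (∑ bs y))
      (split valueᴵ (∑-*ˡ as (- 1ℚ) x) (∑-*ˡ bs 1ℚ y) (All.head (proj₂ sat₄)))))

    ∑x≤∑y : ∑ as x ≤ ∑ bs y
    ∑x≤∑y = begin
      ∑ as x       ≡⟨ ℚₚ.*-identityˡ _ ⟨
      1ℚ * ∑ as x  ≤⟨ weak-duality 0≤x 0≤y load≤1 1≤cover ⟩
      1ℚ * ∑ bs y  ≡⟨ ℚₚ.*-identityˡ _ ⟩
      ∑ bs y       ∎
      where open ℚₚ.≤-Reasoning

-- Order-preserving injections and the periodic packing

module _ where

  open import Data.Nat using (_+_; _*_; _∸_; _≤_; _<_; _<?_)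

  ∈-embeddings : ∀ {k n} (e : Embedding k n) → e ∈ embeddings k n
  ∈-embeddings done                 = here refl
  ∈-embeddings {zero}      (skip e) = ∈-map⁺ skip (∈-embeddings e)
  ∈-embeddings {suc k} {n} (skip e) = ∈-++⁺ʳ (map keep (embeddings k _)) (∈-map⁺ skip (∈-embeddings e))
  ∈-embeddings             (keep e) = ∈-++⁺ˡ (∈-map⁺ keep (∈-embeddings e))

  skip-injective : ∀ {k n} {e f : Embedding k n} → skip e ≡ skip f → e ≡ f
  skip-injective refl = refl

  keep-injective : ∀ {k n} {e f : Embedding k n} → keep e ≡ keep f → e ≡ f
  keep-injective refl = refl

  embeddings-unique : ∀ k n → Unique (embeddings k n)
  embeddings-unique zero    zero    = [] ∷ []
  embeddings-unique (suc k) zero    = []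
  embeddings-unique zero    (suc n) = Uniqueₚ.map⁺ skip-injective (embeddings-unique zero n)
  embeddings-unique (suc k) (suc n) = Uniqueₚ.++⁺
    (Uniqueₚ.map⁺ keep-injective (embeddings-unique k n))
    (Uniqueₚ.map⁺ skip-injective (embeddings-unique (suc k) n)) disjoint
    where
    disjoint : ∀ {e} → ¬ (e ∈ map keep (embeddings k n) × e ∈ map skip (embeddings (suc k) n))
    disjoint (p , q) with ∈-map⁻ keep p | ∈-map⁻ skip q
    ... | _ , _ , refl | _ , _ , ()

  length-embeddings : ∀ k n → length (embeddings k n) ≡ n C k
  length-embeddings zero    zero    = refl
  length-embeddings (suc k) zero    = refl
  length-embeddings zero    (suc n) = trans (length-map skip (embeddings zero n)) (length-embeddings zero n)
  length-embeddings (suc k) (suc n) = begin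
    length (map keep (embeddings k n) ++ map skip (embeddings (suc k) n))
      ≡⟨ length-++ (map keep (embeddings k n)) ⟩
    length (map keep (embeddings k n)) + length (map skip (embeddings (suc k) n))
      ≡⟨ cong₂ _+_ (trans (length-map keep (embeddings k n)) (length-embeddings k n))
                   (trans (length-map skip (embeddings (suc k) n)) (length-embeddings (suc k) n)) ⟩
    n C k + n C suc k
      ≡⟨ nCk+nC[k+1]≡[n+1]C[k+1] n k ⟩
    suc n C suc k ∎
    where open ≡-Reasoning

  -- val f j is the j-th value of f for j < k, and n for j ≥ k.
  val : ∀ {k n} → Embedding k n → ℕ → ℕ
  val done     _       = 0
  val (skip f) j       = suc (val f j)
  val (keep f) zero    = 0
  val (keep f) (suc j) = suc (val f j)

  val-toℕ : ∀ {k n} (f : Embedding k n) i → val f (toℕ i) ≡ toℕ (f ⟨$⟩ i)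
  val-toℕ (skip f) i       = cong suc (val-toℕ f i)
  val-toℕ (keep f) zero    = refl
  val-toℕ (keep f) (suc i) = cong suc (val-toℕ f i)

  val<n : ∀ {k n} (f : Embedding k n) {j} → j < k → val f j < n
  val<n (skip f) j<k               = s≤s (val<n f j<k)
  val<n (keep f) {zero}  _         = z<s
  val<n (keep f) {suc j} (s≤s j<k) = s≤s (val<n f j<k)

  val-mono : ∀ {k n} (f : Embedding k n) {i j} → i ≤ j → val f i ≤ val f j
  val-mono done     _                 = z≤n
  val-mono (skip f) i≤j               = s≤s (val-mono f i≤j)
  val-mono (keep f) {zero}  _         = z≤n
  val-mono (keep f) {suc i} (s≤s i≤j) = s≤s (val-mono f i≤j)

  val-⊙ : ∀ {k m n} (f : Embedding m n) (e : Embedding k m) {j} → j < k → val (f ⊙ e) j ≡ val f (val e j)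
  val-⊙ done     done     ()
  val-⊙ (skip f) e        j<k               = cong suc (val-⊙ f e j<k)
  val-⊙ (keep f) (skip e) j<k               = cong suc (val-⊙ f e j<k)
  val-⊙ (keep f) (keep e) {zero}  _         = refl
  val-⊙ (keep f) (keep e) {suc j} (s≤s j<k) = cong suc (val-⊙ f e j<k)

  ⊙-injective : ∀ {k m n} (f : Embedding m n) {e e′ : Embedding k m} → f ⊙ e ≡ f ⊙ e′ → e ≡ e′
  ⊙-injective done                         eq = eq
  ⊙-injective (skip f)                     eq = ⊙-injective f (skip-injective eq)
  ⊙-injective (keep f) {skip e} {skip e′}  eq = cong skip (⊙-injective f (skip-injective eq))
  ⊙-injective (keep f) {keep e} {keep e′}  eq = cong keep (⊙-injective f (keep-injective eq))

  _⊑_ : ∀ {k l n} → Embedding k n → Embedding l n → Set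
  _⊑_ {k} {l} f g = ∀ {i} → i < k → ∃ λ j → j < l × val f i ≡ val g j

  -- A thinning is recovered from its set of values: if one of the two keeps 0 and the other skips
  -- it, then 0 is a value of only one of them.
  ⊑-antisym : ∀ {k n} {f g : Embedding k n} → f ⊑ g → g ⊑ f → f ≡ g
  ⊑-antisym {f = done} {done} _ _ = refl
  ⊑-antisym {f = skip f} {skip g} f⊑g g⊑f = cong skip (⊑-antisym (unskip f⊑g) (unskip g⊑f))
    where
    unskip : ∀ {k l n} {f : Embedding k n} {g : Embedding l n} → skip f ⊑ skip g → f ⊑ g
    unskip h i<k with h i<k
    ... | j , j<l , eq = j , j<l , ℕₚ.suc-injective eq
  ⊑-antisym {f = keep f} {keep g} f⊑g g⊑f = cong keep (⊑-antisym (unkeep f⊑g) (unkeep g⊑f))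
    where
    unkeep : ∀ {k l n} {f : Embedding k n} {g : Embedding l n} → keep f ⊑ keep g → f ⊑ g
    unkeep h i<k with h (s≤s i<k)
    ... | suc j , s≤s j<l , eq = j , j<l , ℕₚ.suc-injective eq
  ⊑-antisym {f = keep f} {skip g} f⊑g _ with f⊑g z<s
  ... | _ , _ , ()
  ⊑-antisym {f = skip f} {keep g} _ g⊑f with g⊑f z<s
  ... | _ , _ , ()

  window : ∀ j r s → j + r ≤ s → Embedding r s
  window zero    zero    zero    _       = done
  window zero    zero    (suc s) _       = skip (window 0 0 s z≤n)
  window zero    (suc r) (suc s) (s≤s h) = keep (window 0 r s h)
  window (suc j) r       (suc s) (s≤s h) = skip (window j r s h)

  val-window : ∀ j r s (h : j + r ≤ s) {i} → i < r → val (window j r s h) i ≡ j + i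
  val-window zero    (suc r) (suc s) (s≤s h) {zero}  _         = refl
  val-window zero    (suc r) (suc s) (s≤s h) {suc i} (s≤s i<r) = cong suc (val-window 0 r s h i<r)
  val-window (suc j) r       (suc s) (s≤s h)         i<r       = cong suc (val-window j r s h i<r)

  window∈edges : ∀ j r s (h : j + r ≤ s) → window j r s h ∈ edges (P r s)
  window∈edges j r s h = ∈-filter⁺ (edge? (P r s)) (∈-embeddings (window j r s h))
    (fromℕ< j< , λ i → begin
      toℕ (window j r s h ⟨$⟩ i)  ≡⟨ val-toℕ (window j r s h) i ⟨
      val (window j r s h) (toℕ i) ≡⟨ val-window j r s h (Finₚ.toℕ<n i) ⟩
      j + toℕ i                    ≡⟨ cong (_+ toℕ i) (Finₚ.toℕ-fromℕ< j<) ⟨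
      toℕ (fromℕ< j<) + toℕ i     ∎)
    where
    open ≡-Reasoning
    j< : j < suc s ∸ r
    j< = ℕₚ.m+n≤o⇒m≤o∸n (suc j) (s≤s h)

  val-copyEdge : ∀ {r s n} (f : Embedding s n) {e} → e ∈ copyEdges n (P r s) f →
                 ∃ λ j → j + r ≤ s × (∀ {i} → i < r → val e i ≡ val f (j + i))
  val-copyEdge {r} {s} f e∈ with ∈-map⁻ (f ⊙_) e∈
  ... | d , d∈ , refl with ∈-filter⁻ (edge? (P r s)) {xs = embeddings r s} d∈
  ...   | _ , j , d≗ = toℕ j , fits , λ {i} i<r → trans (val-⊙ f d i<r) (cong (val f) (val-d i<r))
    where
    fits : toℕ j + r ≤ s
    fits = ℕₚ.≤-pred (ℕₚ.m≤o∸n⇒m+n≤o (suc (toℕ j)) r≤1+s (Finₚ.toℕ<n j))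
      where
      r≤1+s : r ≤ suc s
      r≤1+s = ℕₚ.<⇒≤ (ℕₚ.m∸n≢0⇒n<m (ℕₚ.m<n⇒n≢0 (Finₚ.toℕ<n j)))
    val-d : ∀ {i} → i < r → val d i ≡ toℕ j + i
    val-d {i} i<r = begin
      val d i                       ≡⟨ cong (val d) (Finₚ.toℕ-fromℕ< i<r) ⟨
      val d (toℕ (fromℕ< i<r))    ≡⟨ val-toℕ d (fromℕ< i<r) ⟩
      toℕ (d ⟨$⟩ fromℕ< i<r)      ≡⟨ d≗ (fromℕ< i<r) ⟩
      toℕ j + toℕ (fromℕ< i<r)     ≡⟨ cong (toℕ j +_) (Finₚ.toℕ-fromℕ< i<r) ⟩
      toℕ j + i                     ∎
      where open ≡-Reasoning

  infixr 6 _⊞_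

  _⊞_ : ∀ {k l m n} → Embedding k m → Embedding l n → Embedding (k + l) (m + n)
  done   ⊞ g = g
  skip f ⊞ g = skip (f ⊞ g)
  keep f ⊞ g = keep (f ⊞ g)

  val-⊞ˡ : ∀ {k l m n} (f : Embedding k m) (g : Embedding l n) {j} → j < k → val (f ⊞ g) j ≡ val f j
  val-⊞ˡ (skip f) g         j<k       = cong suc (val-⊞ˡ f g j<k)
  val-⊞ˡ (keep f) g {zero}  _         = refl
  val-⊞ˡ (keep f) g {suc j} (s≤s j<k) = cong suc (val-⊞ˡ f g j<k)

  val-⊞ʳ : ∀ {k l m n} (f : Embedding k m) (g : Embedding l n) {j} → k ≤ j → val (f ⊞ g) j ≡ m + val g (j ∸ k)
  val-⊞ʳ done     g         _         = refl
  val-⊞ʳ (skip f) g         k≤j       = cong suc (val-⊞ʳ f g k≤j)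
  val-⊞ʳ (keep f) g {suc j} (s≤s k≤j) = cong suc (val-⊞ʳ f g k≤j)

  pad : ∀ {k m n} → Embedding k m → m ≤ n → Embedding k n
  pad {n = zero}  done     _         = done
  pad {n = suc n} done     _         = skip (pad done z≤n)
  pad             (skip f) (s≤s m≤n) = skip (pad f m≤n)
  pad             (keep f) (s≤s m≤n) = keep (pad f m≤n)

  val-pad : ∀ {k m n} (f : Embedding k m) (m≤n : m ≤ n) {j} → j < k → val (pad f m≤n) j ≡ val f j
  val-pad (skip f) (s≤s m≤n)         j<k       = cong suc (val-pad f m≤n j<k)
  val-pad (keep f) (s≤s m≤n) {zero}  _         = refl
  val-pad (keep f) (s≤s m≤n) {suc j} (s≤s j<k) = cong suc (val-pad f m≤n j<k)

  repeat : ∀ {r m} t → Embedding r m → Embedding (t * r) (t * m)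
  repeat zero    x = done
  repeat (suc t) x = x ⊞ repeat t x

  -- Position j lies in the translate numbered j / r, at place j % r of `x`, and the offset of that
  -- translate is a multiple of m.
  val-repeat : ∀ {r m} .{{_ : NonZero r}} .{{_ : NonZero m}} t (x : Embedding r m) {j} → j < t * r →
               val (repeat t x) j % m ≡ val x (j % r)
  val-repeat {r} {m} (suc t) x {j} j< with j <? r
  ... | yes j<r = begin
    val (x ⊞ repeat t x) j % m  ≡⟨ cong (_% m) (val-⊞ˡ x (repeat t x) j<r) ⟩
    val x j % m                  ≡⟨ m<n⇒m%n≡m (val<n x j<r) ⟩
    val x j                      ≡⟨ cong (val x) (m<n⇒m%n≡m j<r) ⟨
    val x (j % r)                ∎
    where open ≡-Reasoning
  ... | no j≮r = begin
    val (x ⊞ repeat t x) j % m        ≡⟨ cong (_% m) (trans (val-⊞ʳ x (repeat t x) r≤j) (ℕₚ.+-comm m _)) ⟩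
    (val (repeat t x) (j ∸ r) + m) % m ≡⟨ [m+n]%n≡m%n (val (repeat t x) (j ∸ r)) m ⟩
    val (repeat t x) (j ∸ r) % m
      ≡⟨ val-repeat t x (ℕₚ.+-cancelˡ-< r (j ∸ r) (t * r) (subst (_< r + t * r) (sym (ℕₚ.m+[n∸m]≡n r≤j)) j<)) ⟩
    val x ((j ∸ r) % r)               ≡⟨ cong (val x) (m≤n⇒[n∸m]%m≡n%m r≤j) ⟩
    val x (j % r)                      ∎
    where
    open ≡-Reasoning
    r≤j = ℕₚ.≮⇒≥ j≮r

  residue : ∀ r .{{_ : NonZero r}} j {i} → i < r → ∃ λ k → k < r × (j + k) % r ≡ i
  residue r j {i} i<r = k , m%n<n _ r , (begin
    (j + k) % r                   ≡⟨ %-distribˡ-+ j k r ⟩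
    (j % r + k % r) % r           ≡⟨ cong (λ a → (j % r + a) % r) (m%n%n≡m%n k′ r) ⟩
    (j % r + k′ % r) % r          ≡⟨ cong (λ a → (a + k′ % r) % r) (m%n%n≡m%n j r) ⟨
    (j % r % r + k′ % r) % r      ≡⟨ %-distribˡ-+ (j % r) k′ r ⟨
    (j % r + (r ∸ j % r + i)) % r ≡⟨ cong (_% r) (ℕₚ.+-assoc (j % r) (r ∸ j % r) i) ⟨
    (j % r + (r ∸ j % r) + i) % r ≡⟨ cong (λ a → (a + i) % r) (ℕₚ.m+[n∸m]≡n (ℕₚ.<⇒≤ (m%n<n j r))) ⟩
    (r + i) % r                   ≡⟨ cong (_% r) (ℕₚ.+-comm r i) ⟩
    (i + r) % r                   ≡⟨ [m+n]%n≡m%n i r ⟩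
    i % r                         ≡⟨ m<n⇒m%n≡m i<r ⟩
    i                             ∎)
    where
    open ≡-Reasoning
    k′ k : ℕ
    -- A solution of j + k ≡ i modulo r; starting from r keeps the subtraction from being truncated.
    k′ = r ∸ j % r + i
    k  = k′ % r

  module _ (r t m n : ℕ) .{{_ : NonZero r}} .{{_ : NonZero t}} .{{_ : NonZero m}} (tm≤n : t * m ≤ n) where

    periodicCopy : Embedding r m → Copy n (P r (t * r))
    periodicCopy x = pad (repeat t x) tm≤n

    -- Modulo m, every edge of the periodic copy of x has the vertex set x.
    val-periodicCopy : ∀ x {e} → e ∈ copyEdges n (P r (t * r)) (periodicCopy x) →
      ∃ λ j → ∀ {i} → i < r → val e i % m ≡ val x ((j + i) % r)
    val-periodicCopy x e∈ with val-copyEdge (periodicCopy x) e∈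
    ... | j , j+r≤tr , val-e = j , λ {i} i<r →
      let j+i<tr = ℕₚ.<-≤-trans (ℕₚ.+-monoʳ-< j i<r) j+r≤tr in
      trans (cong (_% m) (trans (val-e i<r) (val-pad (repeat t x) tm≤n j+i<tr))) (val-repeat t x j+i<tr)

    -- Vertex k of the common edge reduces modulo m to place (j + k) % r of `x` and to place (l + k)
    -- % r of `y`. As k runs through 0, ..., r - 1, the first of these runs through all places of
    -- `x`.
    common-edge⇒⊑ : ∀ x y {e} → e ∈ copyEdges n (P r (t * r)) (periodicCopy x) →
                    e ∈ copyEdges n (P r (t * r)) (periodicCopy y) → x ⊑ y
    common-edge⇒⊑ x y {e} e∈x e∈y {i} i<r with val-periodicCopy x e∈x | val-periodicCopy y e∈y
    ... | j , e≗x | l , e≗y with residue r j i<r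
    ...   | k , k<r , j+k≡i = (l + k) % r , m%n<n (l + k) r ,
              trans (cong (val x) (sym j+k≡i)) (trans (sym (e≗x k<r)) (e≗y k<r))

    common-edge⇒≡ : ∀ {x y e} → e ∈ copyEdges n (P r (t * r)) (periodicCopy x) →
                    e ∈ copyEdges n (P r (t * r)) (periodicCopy y) → x ≡ y
    common-edge⇒≡ {x} {y} p q = ⊑-antisym (common-edge⇒⊑ x y p q) (common-edge⇒⊑ y x q p)

    periodicPacking : List (Copy n (P r (t * r)))
    periodicPacking = map periodicCopy (embeddings r m)

    periodicPacking-isPacking : IsPacking n (P r (t * r)) periodicPacking
    periodicPacking-isPacking = AllPairsₚ.map⁺ (AllPairs.map separated (embeddings-unique r m))
      where
      first : Embedding r (t * r)
      first = window 0 r (t * r) (ℕₚ.m≤n*m r t)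
      separated : ∀ {x y} → x ≢ y → periodicCopy x ≢ periodicCopy y ×
                  EdgeDisjoint n (P r (t * r)) (periodicCopy x) (periodicCopy y)
      separated {x} {y} x≢y =
        -- Distinctness of the copies also reduces to common edges: equal copies share the image of
        -- the first window, which exists because t ≥ 1.
        (λ eq → x≢y (common-edge⇒≡ (first∈ x) (subst (λ f → periodicCopy x ⊙ first ∈ copyEdges n (P r (t * r)) f) eq (first∈ x)))) ,
        (λ (p , q) → x≢y (common-edge⇒≡ p q))
        where
        first∈ : ∀ x → periodicCopy x ⊙ first ∈ copyEdges n (P r (t * r)) (periodicCopy x)
        first∈ x = ∈-map⁺ (periodicCopy x ⊙_) (window∈edges 0 r (t * r) (ℕₚ.m≤n*m r t))

    length-periodicPacking : length periodicPacking ≡ m C r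
    length-periodicPacking = trans (length-map periodicCopy (embeddings r m)) (length-embeddings r m)

-- The interval transversal

ι : ℕ → ℚ
ι n = ℤ.+ n ℚ./ 1

toℚᵘ-ι : ∀ n → ℚ.toℚᵘ (ι n) ℚᵘ.≃ mkℚᵘ (ℤ.+ n) 0
toℚᵘ-ι n = ℚₚ.toℚᵘ-fromℚᵘ (mkℚᵘ (ℤ.+ n) 0)

ι-+ : ∀ m n → ι (m ℕ.+ n) ≡ ι m ℚ.+ ι n
ι-+ m n = ℚₚ.toℚᵘ-injective (begin
  ℚ.toℚᵘ (ι (m ℕ.+ n))                     ≈⟨ toℚᵘ-ι (m ℕ.+ n) ⟩
  mkℚᵘ (ℤ.+ (m ℕ.+ n)) 0
    ≈⟨ ℚᵘ.*≡* (cong (ℤ._* ℤ.+ 1) (cong₂ ℤ._+_ (sym (ℤₚ.*-identityʳ (ℤ.+ m))) (sym (ℤₚ.*-identityʳ (ℤ.+ n))))) ⟩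
  mkℚᵘ (ℤ.+ m) 0 ℚᵘ.+ mkℚᵘ (ℤ.+ n) 0           ≈⟨ ℚᵘₚ.+-cong (toℚᵘ-ι m) (toℚᵘ-ι n) ⟨
  ℚ.toℚᵘ (ι m) ℚᵘ.+ ℚ.toℚᵘ (ι n)           ≈⟨ ℚₚ.toℚᵘ-homo-+ (ι m) (ι n) ⟨
  ℚ.toℚᵘ (ι m ℚ.+ ι n)                     ∎)
  where open ℚᵘₚ.≃-Reasoning

ι-* : ∀ m n → ι (m ℕ.* n) ≡ ι m ℚ.* ι n
ι-* m n = ℚₚ.toℚᵘ-injective (begin
  ℚ.toℚᵘ (ι (m ℕ.* n))                     ≈⟨ toℚᵘ-ι (m ℕ.* n) ⟩
  mkℚᵘ (ℤ.+ (m ℕ.* n)) 0                     ≈⟨ ℚᵘ.*≡* (cong (ℤ._* ℤ.+ 1) (ℤₚ.pos-* m n)) ⟩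
  mkℚᵘ (ℤ.+ m) 0 ℚᵘ.* mkℚᵘ (ℤ.+ n) 0           ≈⟨ ℚᵘₚ.*-cong (toℚᵘ-ι m) (toℚᵘ-ι n) ⟨
  ℚ.toℚᵘ (ι m) ℚᵘ.* ℚ.toℚᵘ (ι n)           ≈⟨ ℚₚ.toℚᵘ-homo-* (ι m) (ι n) ⟨
  ℚ.toℚᵘ (ι m ℚ.* ι n)                     ∎)
  where open ℚᵘₚ.≃-Reasoning

ι-mono : ∀ {m n} → m ℕ.≤ n → ι m ℚ.≤ ι n
ι-mono {m} {n} m≤n = ℚₚ.toℚᵘ-cancel-≤ (ℚᵘₚ.≤-respˡ-≃ (ℚᵘₚ.≃-sym (toℚᵘ-ι m)) (ℚᵘₚ.≤-respʳ-≃ (ℚᵘₚ.≃-sym (toℚᵘ-ι n))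
  (ℚᵘ.*≤* (ℤₚ.*-monoʳ-≤-nonNeg (ℤ.+ 1) (ℤ.+≤+ m≤n)))))

ι-cancel : ∀ {m n} → ι m ℚ.≤ ι n → m ℕ.≤ n
ι-cancel {m} {n} h with ℚᵘₚ.≤-respˡ-≃ (toℚᵘ-ι m) (ℚᵘₚ.≤-respʳ-≃ (toℚᵘ-ι n) (ℚₚ.toℚᵘ-mono-≤ h))
... | ℚᵘ.*≤* h′ = ℤₚ.drop‿+≤+ (ℤₚ.*-cancelʳ-≤-pos (ℤ.+ m) (ℤ.+ n) (ℤ.+ 1) h′)

0≤ι : ∀ n → 0ℚ ℚ.≤ ι n
0≤ι n = ι-mono {0} {n} z≤n

ι*1/ : ∀ n .{{_ : NonZero n}} → ι n ℚ.* (ℤ.+ 1 ℚ./ n) ≡ 1ℚ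
ι*1/ n@(suc k) = ℚₚ.toℚᵘ-injective (begin
  ℚ.toℚᵘ (ι n ℚ.* (ℤ.+ 1 ℚ./ n))             ≈⟨ ℚₚ.toℚᵘ-homo-* (ι n) (ℤ.+ 1 ℚ./ n) ⟩
  ℚ.toℚᵘ (ι n) ℚᵘ.* ℚ.toℚᵘ (ℤ.+ 1 ℚ./ n)     ≈⟨ ℚᵘₚ.*-cong (toℚᵘ-ι n) (ℚₚ.toℚᵘ-fromℚᵘ (mkℚᵘ (ℤ.+ 1) k)) ⟩
  mkℚᵘ (ℤ.+ n) 0 ℚᵘ.* mkℚᵘ (ℤ.+ 1) k           ≈⟨ ℚᵘ.*≡* (cross-multiplied n) ⟩
  mkℚᵘ (ℤ.+ 1) 0                             ∎)
  where
  open ℚᵘₚ.≃-Reasoning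
  cross-multiplied : ∀ n → (ℤ.+ n ℤ.* ℤ.+ 1) ℤ.* ℤ.+ 1 ≡ ℤ.+ 1 ℤ.* ℤ.+ (1 ℕ.* n)
  cross-multiplied n = trans (ℤₚ.*-identityʳ _) (trans (ℤₚ.*-identityʳ (ℤ.+ n))
    (sym (trans (ℤₚ.*-identityˡ _) (cong ℤ.+_ (ℕₚ.*-identityˡ n)))))

0≤1/ : ∀ n .{{_ : NonZero n}} → 0ℚ ℚ.≤ ℤ.+ 1 ℚ./ n
0≤1/ n = ℚₚ.nonNegative⁻¹ (ℤ.+ 1 ℚ./ n) {{ℚₚ.normalize-nonNeg 1 n}}

module _ where

  open import Data.Rational using (_+_; _*_; _-_; -_; _≤_)
  open ℚSolver.+-*-Solver using (solve; _:+_; _:*_; _:-_; _:=_; con)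

  ∑-const : ∀ {A : Set} (xs : List A) c → ∑ xs (const c) ≡ ι (length xs) * c
  ∑-const []       c = sym (ℚₚ.*-zeroˡ c)
  ∑-const (x ∷ xs) c = begin
    c + ∑ xs (const c)          ≡⟨ cong (c +_) (∑-const xs c) ⟩
    c + ι (length xs) * c       ≡⟨ solve 2 (λ c l → c :+ l :* c := (con 1ℚ :+ l) :* c) refl c (ι (length xs)) ⟩
    (1ℚ + ι (length xs)) * c    ≡⟨ cong (_* c) (ι-+ 1 (length xs)) ⟨
    ι (length (x ∷ xs)) * c     ∎
    where open ≡-Reasoning

  term≤∑ : ∀ {A : Set} {xs : List A} {a} {f : A → ℚ} → (∀ a → 0ℚ ≤ f a) → a ∈ xs → f a ≤ ∑ xs f
  term≤∑ {xs = x ∷ xs} {f = f} 0≤f (here refl) =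
    subst (_≤ f x + ∑ xs f) (ℚₚ.+-identityʳ (f x)) (ℚₚ.+-monoʳ-≤ (f x) (∑-nonNeg xs 0≤f))
  term≤∑ {xs = x ∷ xs} {a} {f} 0≤f (there a∈) = ℚₚ.≤-trans (term≤∑ 0≤f a∈)
    (subst (_≤ f x + ∑ xs f) (ℚₚ.+-identityˡ (∑ xs f)) (ℚₚ.+-monoˡ-≤ (∑ xs f) (0≤f x)))

  ∑-applyDownFrom : ∀ {A : Set} (h : ℕ → A) n (f : A → ℚ) → ∑ (applyDownFrom h n) f ≡ ∑ (downFrom n) (f ∘ h)
  ∑-applyDownFrom h zero    f = refl
  ∑-applyDownFrom h (suc n) f = cong (f (h n) +_) (∑-applyDownFrom h n f)

  ∑-shift : ∀ n (φ : ℕ → ℚ) → ∑ (downFrom n) (φ ∘ suc) + φ 0 ≡ ∑ (downFrom n) φ + φ n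
  ∑-shift zero    φ = refl
  ∑-shift (suc n) φ = begin
    φ (suc n) + ∑ (downFrom n) (φ ∘ suc) + φ 0    ≡⟨ ℚₚ.+-assoc (φ (suc n)) (∑ (downFrom n) (φ ∘ suc)) (φ 0) ⟩
    φ (suc n) + (∑ (downFrom n) (φ ∘ suc) + φ 0)  ≡⟨ cong (φ (suc n) +_) (∑-shift n φ) ⟩
    φ (suc n) + (∑ (downFrom n) φ + φ n)
      ≡⟨ solve 3 (λ a b c → a :+ (b :+ c) := (c :+ b) :+ a) refl (φ (suc n)) (∑ (downFrom n) φ) (φ n) ⟩
    φ n + ∑ (downFrom n) φ + φ (suc n)            ∎
    where open ≡-Reasoning

  -- A shift by 1 drops `φ 0`, which is nonnegative, and brings in one new term, which is at most
  -- `B`.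
  ∑-shift-≤ : ∀ n d {B} (φ : ℕ → ℚ) → (∀ j → 0ℚ ≤ φ j) → (∀ j → φ j ≤ B) →
              ∑ (downFrom n) (λ j → φ (j ℕ.+ d)) ≤ ∑ (downFrom n) φ + ι d * B
  ∑-shift-≤ n zero {B} φ 0≤φ φ≤B = ℚₚ.≤-reflexive (begin
    ∑ (downFrom n) (λ j → φ (j ℕ.+ 0))  ≡⟨ ∑-cong (downFrom n) (λ {j} _ → cong φ (ℕₚ.+-identityʳ j)) ⟩
    ∑ (downFrom n) φ                    ≡⟨ solve 2 (λ s b → s := s :+ con 0ℚ :* b) refl (∑ (downFrom n) φ) B ⟩
    ∑ (downFrom n) φ + 0ℚ * B           ∎)
    where open ≡-Reasoning
  ∑-shift-≤ n (suc d) {B} φ 0≤φ φ≤B = begin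
    ∑ (downFrom n) (λ j → φ (j ℕ.+ suc d))
      ≡⟨ ∑-cong (downFrom n) (λ {j} _ → cong φ (ℕₚ.+-suc j d)) ⟩
    ∑ (downFrom n) (λ j → φ (suc (j ℕ.+ d)))
      ≤⟨ ∑-shift-≤ n d (φ ∘ suc) (0≤φ ∘ suc) (φ≤B ∘ suc) ⟩
    ∑ (downFrom n) (φ ∘ suc) + ι d * B
      ≤⟨ ℚₚ.+-monoˡ-≤ (ι d * B) step ⟩
    ∑ (downFrom n) φ + B + ι d * B
      ≡⟨ solve 3 (λ s b k → s :+ b :+ k :* b := s :+ (con 1ℚ :+ k) :* b) refl (∑ (downFrom n) φ) B (ι d) ⟩
    ∑ (downFrom n) φ + (1ℚ + ι d) * B
      ≡⟨ cong (λ k → ∑ (downFrom n) φ + k * B) (ι-+ 1 d) ⟨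
    ∑ (downFrom n) φ + ι (suc d) * B ∎
    where
    open ℚₚ.≤-Reasoning
    step : ∑ (downFrom n) (φ ∘ suc) ≤ ∑ (downFrom n) φ + B
    step = begin
      ∑ (downFrom n) (φ ∘ suc)        ≡⟨ ℚₚ.+-identityʳ (∑ (downFrom n) (φ ∘ suc)) ⟨
      ∑ (downFrom n) (φ ∘ suc) + 0ℚ   ≤⟨ ℚₚ.+-monoʳ-≤ (∑ (downFrom n) (φ ∘ suc)) (0≤φ 0) ⟩
      ∑ (downFrom n) (φ ∘ suc) + φ 0  ≡⟨ ∑-shift n φ ⟩
      ∑ (downFrom n) φ + φ n          ≤⟨ ℚₚ.+-monoʳ-≤ (∑ (downFrom n) φ) (φ≤B n) ⟩
      ∑ (downFrom n) φ + B            ∎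

  -- Each window with φ j ≠ φ (j + d) raises φ by at least 1, while all the increases
  -- together telescope to at most d t.
  many-constant-windows : ∀ d t (φ : ℕ → ℕ) → (∀ {i j} → i ℕ.≤ j → φ i ℕ.≤ φ j) → (∀ j → φ j ℕ.≤ t) →
    ι (suc t) ≤ ∑ (downFrom (suc (t ℕ.* suc d))) (λ j → 𝟙 (φ j ℕ.≟ φ (j ℕ.+ d)))
  many-constant-windows d t φ φ-mono φ≤t = 0≤q-p⇒p≤q (subst (0ℚ ≤_)
    (trans (cong (λ k → (∑ js g + (∑ js φ′ + ι d * ι t)) - (k + ∑ js φ′)) ιL)
      (solve 4 (λ g s p k → (g :+ (s :+ p)) :- ((k :+ p) :+ s) := g :- k) refl (∑ js g) (∑ js φ′) (ι d * ι t) (ι (suc t))))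
    (p≤q⇒0≤q-p (begin
      ι L + ∑ js φ′
        ≡⟨ cong (_+ ∑ js φ′) (trans (∑-const js 1ℚ) (trans (cong (λ k → ι k * 1ℚ) (length-downFrom L)) (ℚₚ.*-identityʳ (ι L)))) ⟨
      ∑ js (const 1ℚ) + ∑ js φ′                ≡⟨ ∑-+ js (const 1ℚ) φ′ ⟨
      ∑ js (λ j → 1ℚ + φ′ j)                   ≤⟨ ∑-mono js (λ {j} _ → step j) ⟩
      ∑ js (λ j → g j + φ′ (j ℕ.+ d))          ≡⟨ ∑-+ js g (λ j → φ′ (j ℕ.+ d)) ⟩
      ∑ js g + ∑ js (λ j → φ′ (j ℕ.+ d))
        ≤⟨ ℚₚ.+-monoʳ-≤ (∑ js g) (∑-shift-≤ L d φ′ (0≤ι ∘ φ) (ι-mono ∘ φ≤t)) ⟩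
      ∑ js g + (∑ js φ′ + ι d * ι t)           ∎)))
    where
    open ℚₚ.≤-Reasoning
    L : ℕ
    -- The number s - r + 1 of windows, for r = d + 1 and s = (t + 1)r. Since it equals (t + 1) + d
    -- t, spending d t on the increases leaves t + 1.
    L = suc (t ℕ.* suc d)
    js : List ℕ
    js = downFrom L
    φ′ g : ℕ → ℚ
    φ′ = ι ∘ φ
    g j = 𝟙 (φ j ℕ.≟ φ (j ℕ.+ d))
    ιL : ι L ≡ ι (suc t) + ι d * ι t
    ιL = trans (cong ι (cong suc (trans (ℕₚ.*-suc t d) (cong (t ℕ.+_) (ℕₚ.*-comm t d)))))
      (trans (ι-+ (suc t) (d ℕ.* t)) (cong (ι (suc t) +_) (ι-* d t)))
    step : ∀ j → 1ℚ + φ′ j ≤ g j + φ′ (j ℕ.+ d)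
    step j = by-cases (φ j ℕ.≟ φ (j ℕ.+ d))
      where
      by-cases : (eq? : Dec (φ j ≡ φ (j ℕ.+ d))) → 1ℚ + φ′ j ≤ 𝟙 eq? + φ′ (j ℕ.+ d)
      by-cases (yes eq) = ℚₚ.≤-reflexive (cong (λ k → 1ℚ + ι k) eq)
      by-cases (no neq) = subst (1ℚ + φ′ j ≤_) (sym (ℚₚ.+-identityˡ (φ′ (j ℕ.+ d))))
        (subst (_≤ φ′ (j ℕ.+ d)) (ι-+ 1 (φ j)) (ι-mono (ℕₚ.≤∧≢⇒< (φ-mono (ℕₚ.m≤m+n j d)) neq)))

  -- Whether all values lie between a and a + m - 1, decided by recursion on the thinning: `a`
  -- counts the positions still to pass, then `m` those left in the interval. Counting can then
  -- follow Pascal's rule.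
  inside : ∀ {k n} → ℕ → ℕ → Embedding k n → Bool
  inside _       _       done     = true
  inside (suc a) m       (skip e) = inside a m e
  inside (suc a) m       (keep e) = false
  inside zero    (suc m) (skip e) = inside zero m e
  inside zero    (suc m) (keep e) = inside zero m e
  inside zero    zero    (skip e) = inside zero zero e
  inside zero    zero    (keep e) = false

  inside⁺ : ∀ {k n} a m (e : Embedding k n) →
            (∀ {i} → i ℕ.< k → a ℕ.≤ val e i × val e i ℕ.< a ℕ.+ m) → inside a m e ≡ true
  inside⁺ a       m       done     h = refl
  inside⁺ (suc a) m       (skip e) h = inside⁺ a m e λ i<k →
    let p , q = h i<k in ℕₚ.≤-pred p , ℕₚ.≤-pred q
  inside⁺ (suc a) m       (keep e) h with h z<s
  ... | () , _
  inside⁺ zero    (suc m) (skip e) h = inside⁺ zero m e λ i<k → z≤n , ℕₚ.≤-pred (proj₂ (h i<k))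
  inside⁺ zero    (suc m) (keep e) h = inside⁺ zero m e λ i<k → z≤n , ℕₚ.≤-pred (proj₂ (h (s≤s i<k)))
  inside⁺ zero    zero    (skip e) h = inside⁺ zero zero e λ i<k → contradiction (proj₂ (h i<k)) λ ()
  inside⁺ zero    zero    (keep e) h with h z<s
  ... | _ , ()

  𝟙ᴵ : ∀ {k n} → ℕ → ℕ → Embedding k n → ℚ
  𝟙ᴵ a m e = 𝟙 (T? (inside a m e))

  0≤𝟙ᴵ : ∀ {k n} a m (e : Embedding k n) → 0ℚ ≤ 𝟙ᴵ a m e
  0≤𝟙ᴵ a m e = 𝟙-nonNeg (T? (inside a m e))

  countInside : ∀ k n a m → ℚ
  countInside k n a m = ∑ (embeddings k n) (𝟙ᴵ a m)

  -- Only positions inside the interval may be kept, and each of them contributes one step of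
  -- Pascal's rule. Equality can fail, since the interval may extend beyond n.
  countInside≤ : ∀ k n a m → countInside k n a m ≤ ι (m C k)
  countInside≤ zero    zero    a       m       = ℚₚ.≤-refl
  countInside≤ (suc k) zero    a       m       = 0≤ι (m C suc k)
  countInside≤ zero    (suc n) (suc a) m       =
    subst (_≤ ι (m C 0)) (sym (∑-map skip (embeddings 0 n) (𝟙ᴵ (suc a) m))) (countInside≤ zero n a m)
  countInside≤ zero    (suc n) zero    (suc m) =
    subst (_≤ ι (m C 0)) (sym (∑-map skip (embeddings 0 n) (𝟙ᴵ 0 (suc m)))) (countInside≤ zero n zero m)
  countInside≤ zero    (suc n) zero    zero    =
    subst (_≤ ι (0 C 0)) (sym (∑-map skip (embeddings 0 n) (𝟙ᴵ 0 0))) (countInside≤ zero n zero zero)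
  countInside≤ (suc k) (suc n) a m = subst (_≤ ι (m C suc k))
    (sym (trans (∑-++ (map keep (embeddings k n)) (map skip (embeddings (suc k) n)) I)
      (cong₂ _+_ (∑-map keep (embeddings k n) I) (∑-map skip (embeddings (suc k) n) I))))
    (split a m)
    where
    I : Embedding (suc k) (suc n) → ℚ
    I = 𝟙ᴵ a m
    0+ : ∀ {p q} → p ≤ q → ∑ (embeddings k n) (const 0ℚ) + p ≤ q
    0+ {p} {q} = subst (_≤ q) (sym (trans (cong (_+ p) (∑-0 (embeddings k n))) (ℚₚ.+-identityˡ p)))
    split : ∀ a m → ∑ (embeddings k n) (λ e → 𝟙ᴵ a m (keep e)) +
                    ∑ (embeddings (suc k) n) (λ e → 𝟙ᴵ a m (skip e)) ≤ ι (m C suc k)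
    split (suc a) m = 0+ (countInside≤ (suc k) n a m)
    split zero (suc m) = subst (countInside k n 0 m + countInside (suc k) n 0 m ≤_)
      (trans (sym (ι-+ (m C k) (m C suc k))) (cong ι (nCk+nC[k+1]≡[n+1]C[k+1] m k)))
      (ℚₚ.+-mono-≤ (countInside≤ k n zero m) (countInside≤ (suc k) n zero m))
    split zero zero = 0+ (countInside≤ (suc k) n zero zero)

  module _ (d t m n : ℕ) .{{_ : NonZero m}} (n≤ : n ℕ.≤ suc t ℕ.* m) where

    private
      r = suc d
      s = suc t ℕ.* r

    -- The number of intervals is `suc t` here, and the last ones may extend beyond n. Written as a
    -- sum over intervals, the weight can be totalled by an exchange of sums.
    intervalWeight : KEdge r n → ℚ
    intervalWeight e = (ℤ.+ 1 ℚ./ suc t) * ∑ (downFrom (suc t)) (λ i → 𝟙ᴵ (i ℕ.* m) m e)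

    0≤intervalWeight : ∀ e → 0ℚ ≤ intervalWeight e
    0≤intervalWeight e = *-nonNeg (0≤1/ (suc t)) (∑-nonNeg (downFrom (suc t)) λ i → 0≤𝟙ᴵ (i ℕ.* m) m e)

    ∑-intervalWeight : ∑ (embeddings r n) intervalWeight ≤ ι (m C r)
    ∑-intervalWeight = begin
      ∑ (embeddings r n) intervalWeight
        ≡⟨ ∑-*ˡ (embeddings r n) (ℤ.+ 1 ℚ./ suc t) _ ⟩
      (ℤ.+ 1 ℚ./ suc t) * ∑ (embeddings r n) (λ e → ∑ is (λ i → 𝟙ᴵ (i ℕ.* m) m e))
        ≡⟨ cong ((ℤ.+ 1 ℚ./ suc t) *_) (∑-swap (embeddings r n) is (λ e i → 𝟙ᴵ (i ℕ.* m) m e)) ⟩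
      (ℤ.+ 1 ℚ./ suc t) * ∑ is (λ i → countInside r n (i ℕ.* m) m)
        ≤⟨ *-monoˡ (0≤1/ (suc t)) (∑-mono is λ {i} _ → countInside≤ r n (i ℕ.* m) m) ⟩
      (ℤ.+ 1 ℚ./ suc t) * ∑ is (const (ι (m C r)))
        ≡⟨ cong ((ℤ.+ 1 ℚ./ suc t) *_) (trans (∑-const is (ι (m C r))) (cong (λ l → ι l * ι (m C r)) (length-downFrom (suc t)))) ⟩
      (ℤ.+ 1 ℚ./ suc t) * (ι (suc t) * ι (m C r))
        ≡⟨ solve 3 (λ a b c → a :* (b :* c) := (b :* a) :* c) refl (ℤ.+ 1 ℚ./ suc t) (ι (suc t)) (ι (m C r)) ⟩
      (ι (suc t) * (ℤ.+ 1 ℚ./ suc t)) * ι (m C r)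
        ≡⟨ trans (cong (_* ι (m C r)) (ι*1/ (suc t))) (ℚₚ.*-identityˡ (ι (m C r))) ⟩
      ι (m C r) ∎
      where
      open ℚₚ.≤-Reasoning
      is : List ℕ
      is = downFrom (suc t)

    intervalWeight-covers : ∀ f → 1ℚ ≤ ∑ (copyEdges n (P r s) f) intervalWeight
    intervalWeight-covers f = begin
      1ℚ
        ≡⟨ trans (ℚₚ.*-comm (ℤ.+ 1 ℚ./ suc t) (ι (suc t))) (ι*1/ (suc t)) ⟨
      (ℤ.+ 1 ℚ./ suc t) * ι (suc t)
        ≤⟨ *-monoˡ (0≤1/ (suc t)) (many-constant-windows d t φ φ-mono (λ j → ℕₚ.m⊓n≤n _ t)) ⟩
      (ℤ.+ 1 ℚ./ suc t) * ∑ (downFrom L) (λ j → 𝟙 (φ j ℕ.≟ φ (j ℕ.+ d)))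
        ≡⟨ ∑-*ˡ (downFrom L) (ℤ.+ 1 ℚ./ suc t) (λ j → 𝟙 (φ j ℕ.≟ φ (j ℕ.+ d))) ⟨
      ∑ (downFrom L) (λ j → (ℤ.+ 1 ℚ./ suc t) * 𝟙 (φ j ℕ.≟ φ (j ℕ.+ d)))
        ≤⟨ ∑-mono (downFrom L) (λ {j} j∈ → *-monoˡ (0≤1/ (suc t)) (constant⇒inside (∈-downFrom⁻ j∈) (φ j ℕ.≟ φ (j ℕ.+ d)))) ⟩
      ∑ (downFrom L) (λ j → intervalWeight (f ⊙ win j))
        ≡⟨ ∑-applyDownFrom win L (λ e → intervalWeight (f ⊙ e)) ⟨
      ∑ (applyDownFrom win L) (λ e → intervalWeight (f ⊙ e))
        ≤⟨ ∑-⊆ _≟ᴱ_ (Uniqueₚ.applyDownFrom⁺₁ win L win-distinct)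
             (Uniqueₚ.filter⁺ (edge? (P r s)) (embeddings-unique r s)) win∈edges (λ e → 0≤intervalWeight (f ⊙ e)) ⟩
      ∑ (edges (P r s)) (λ e → intervalWeight (f ⊙ e))
        ≡⟨ ∑-map (f ⊙_) (edges (P r s)) intervalWeight ⟨
      ∑ (copyEdges n (P r s) f) intervalWeight ∎
      where
      open ℚₚ.≤-Reasoning

      L : ℕ
      L = suc (t ℕ.* r)

      win-fits : ∀ j → j ℕ.⊓ (t ℕ.* r) ℕ.+ r ℕ.≤ s
      win-fits j = ℕₚ.≤-trans (ℕₚ.+-monoˡ-≤ r (ℕₚ.m⊓n≤n j (t ℕ.* r))) (ℕₚ.≤-reflexive (ℕₚ.+-comm (t ℕ.* r) r))

      -- The cap makes `win` total on ℕ; it changes nothing below `L`.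
      win : ℕ → Embedding r s
      win j = window (j ℕ.⊓ (t ℕ.* r)) r s (win-fits j)

      val-win : ∀ {j i} → j ℕ.< L → i ℕ.< r → val (win j) i ≡ j ℕ.+ i
      val-win {j} {i} j<L i<r = trans (val-window _ r s (win-fits j) i<r) (cong (ℕ._+ i) (ℕₚ.m≤n⇒m⊓n≡m (ℕₚ.≤-pred j<L)))

      win∈edges : ∀ {e} → e ∈ applyDownFrom win L → e ∈ edges (P r s)
      win∈edges e∈ with ∈-applyDownFrom⁻ win e∈
      ... | j , _ , refl = window∈edges _ r s (win-fits j)

      win-distinct : ∀ {i j} → j ℕ.< i → i ℕ.< L → win i ≢ win j
      win-distinct {i} {j} j<i i<L eq = ℕₚ.<⇒≢ j<i (ℕₚ.+-cancelʳ-≡ 0 j i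
        (trans (sym (val-win (ℕₚ.<-trans j<i i<L) z<s)) (trans (cong (λ e → val e 0) (sym eq)) (val-win i<L z<s))))

      φ : ℕ → ℕ
      -- The number of the interval containing vertex j. Beyond the path `val` takes the value n,
      -- and n / m may be `suc t`; the cap keeps φ at most t there too, as `many-constant-windows`
      -- asks of every j.
      φ j = (val f j ℕ./ m) ℕ.⊓ t

      φ-mono : ∀ {i j} → i ℕ.≤ j → φ i ℕ.≤ φ j
      φ-mono i≤j = ℕₚ.⊓-monoˡ-≤ t (/-monoˡ-≤ m (val-mono f i≤j))

      φ-val : ∀ {j} → j ℕ.< s → φ j ≡ val f j ℕ./ m
      φ-val j<s = ℕₚ.m≤n⇒m⊓n≡m (ℕₚ.≤-pred (m<n*o⇒m/o<n (ℕₚ.<-≤-trans (val<n f j<s) n≤)))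

      -- The first vertex of the window gives the lower bound and the last one the upper bound; by
      -- monotonicity the vertices between them stay in the same interval.
      in-interval : ∀ {j i} → j ℕ.< L → φ j ≡ φ (j ℕ.+ d) → i ℕ.< r →
                    φ j ℕ.* m ℕ.≤ val (f ⊙ win j) i × val (f ⊙ win j) i ℕ.< φ j ℕ.* m ℕ.+ m
      in-interval {j} {i} j<L eq i<r rewrite val-⊙ f (win j) i<r | val-win {j} {i} j<L i<r = lower , upper
        where
        j+d<s : j ℕ.+ d ℕ.< s
        j+d<s = subst (ℕ._≤ s) (ℕₚ.+-suc j d) (ℕₚ.≤-trans (ℕₚ.+-monoˡ-≤ r (ℕₚ.≤-pred j<L)) (ℕₚ.≤-reflexive (ℕₚ.+-comm (t ℕ.* r) r)))
        lower : φ j ℕ.* m ℕ.≤ val f (j ℕ.+ i)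
        lower = ℕₚ.≤-trans (ℕₚ.*-monoˡ-≤ m (ℕₚ.m⊓n≤m (val f j ℕ./ m) t))
          (ℕₚ.≤-trans (m/n*n≤m (val f j) m) (val-mono f (ℕₚ.m≤m+n j i)))
        upper : val f (j ℕ.+ i) ℕ.< φ j ℕ.* m ℕ.+ m
        upper = ℕₚ.≤-<-trans (val-mono f (ℕₚ.+-monoʳ-≤ j (ℕₚ.≤-pred i<r)))
          (subst (λ k → val f (j ℕ.+ d) ℕ.< k ℕ.* m ℕ.+ m) (sym (trans eq (φ-val j+d<s)))
            (subst (ℕ._< val f (j ℕ.+ d) ℕ./ m ℕ.* m ℕ.+ m) (trans (ℕₚ.+-comm _ (val f (j ℕ.+ d) % m)) (sym (m≡m%n+[m/n]*n (val f (j ℕ.+ d)) m)))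
              (ℕₚ.+-monoʳ-< (val f (j ℕ.+ d) ℕ./ m ℕ.* m) (m%n<n (val f (j ℕ.+ d)) m))))

      constant⇒inside : ∀ {j} → j ℕ.< L → (eq? : Dec (φ j ≡ φ (j ℕ.+ d))) →
        𝟙 eq? ≤ ∑ (downFrom (suc t)) (λ i → 𝟙ᴵ (i ℕ.* m) m (f ⊙ win j))
      constant⇒inside {j} j<L (no _)   = ∑-nonNeg (downFrom (suc t)) (λ i → 0≤𝟙ᴵ (i ℕ.* m) m (f ⊙ win j))
      constant⇒inside {j} j<L (yes eq) = subst (_≤ ∑ (downFrom (suc t)) (λ i → 𝟙ᴵ (i ℕ.* m) m (f ⊙ win j)))
        (cong (λ b → 𝟙 (T? b)) (inside⁺ (φ j ℕ.* m) m (f ⊙ win j) (in-interval j<L eq)))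
        (term≤∑ {a = φ j} (λ i → 0≤𝟙ᴵ (i ℕ.* m) m (f ⊙ win j)) (∈-downFrom⁺ (s≤s (ℕₚ.m⊓n≤n (val f j ℕ./ m) t))))

-- Optimal values of the real programs

≤⇒≤ℝ : ∀ {x y} → (∀ k → seq x k ℚ.≤ seq y k) → x ≤ℝ y
≤⇒≤ℝ {y = y} h ε 0<ε = 0 , λ k _ → ℚₚ.≤-trans (h k)
  (subst (ℚ._≤ seq y k ℚ.+ ε) (ℚₚ.+-identityʳ (seq y k)) (ℚₚ.+-monoʳ-≤ (seq y k) (ℚₚ.<⇒≤ 0<ε)))

≤ℝ-trans : ∀ {x y z} → x ≤ℝ y → y ≤ℝ z → x ≤ℝ z
≤ℝ-trans {x} {y} {z} x≤y y≤z ε 0<ε with x≤y (ℚ.½ ℚ.* ε) half | y≤z (ℚ.½ ℚ.* ε) half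
  where
  half : 0ℚ ℚ.< ℚ.½ ℚ.* ε
  half = subst (ℚ._< ℚ.½ ℚ.* ε) (ℚₚ.*-zeroʳ ℚ.½) (ℚₚ.*-monoʳ-<-pos ℚ.½ 0<ε)
... | M , p | N , q = M ℕ.⊔ N , λ k h → begin
  seq x k                                ≤⟨ p k (ℕₚ.m⊔n≤o⇒m≤o M N h) ⟩
  seq y k ℚ.+ ℚ.½ ℚ.* ε                  ≤⟨ ℚₚ.+-monoˡ-≤ (ℚ.½ ℚ.* ε) (q k (ℕₚ.m⊔n≤o⇒n≤o M N h)) ⟩
  seq z k ℚ.+ ℚ.½ ℚ.* ε ℚ.+ ℚ.½ ℚ.* ε    ≡⟨ ℚₚ.+-assoc (seq z k) (ℚ.½ ℚ.* ε) (ℚ.½ ℚ.* ε) ⟩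
  seq z k ℚ.+ (ℚ.½ ℚ.* ε ℚ.+ ℚ.½ ℚ.* ε)
    ≡⟨ cong (seq z k ℚ.+_) (trans (sym (ℚₚ.*-distribʳ-+ ε ℚ.½ ℚ.½)) (ℚₚ.*-identityˡ ε)) ⟩
  seq z k ℚ.+ ε                          ∎
  where open ℚₚ.≤-Reasoning

seq-sumOver : ∀ {A : Set} (xs : List A) (w : A → ℝ) k → seq (sumOver xs w) k ≡ ∑ xs (λ a → seq (w a) k)
seq-sumOver []       w k = refl
seq-sumOver (x ∷ xs) w k = cong (seq (w x) k ℚ.+_) (seq-sumOver xs w k)

-- The maximum of finitely many thresholds works. This gives a single stage at which all constraints
-- of a finite program hold approximately.
eventually-all : ∀ {A : Set} (xs : List A) {Q : A → ℕ → Set} →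
  (∀ a → ∃ λ N → ∀ k → N ℕ.≤ k → Q a k) → ∃ λ N → ∀ k → N ℕ.≤ k → ∀ {a} → a ∈ xs → Q a k
eventually-all []       h = 0 , λ _ _ ()
eventually-all (x ∷ xs) h with h x | eventually-all xs h
... | M , p | N , q = M ℕ.⊔ N , λ k le → λ where
  (here refl) → p k (ℕₚ.m⊔n≤o⇒m≤o M N le)
  (there a∈)  → q k (ℕₚ.m⊔n≤o⇒n≤o M N le) a∈

small : ∀ {K ε} → 0ℚ ℚ.≤ K → 0ℚ ℚ.< ε → ∃ λ η → 0ℚ ℚ.< η × η ℚ.* K ℚ.≤ ε
small {K} {ε} 0≤K 0<ε = η , 0<η , (begin
  η ℚ.* K              ≤⟨ *-monoˡ (ℚₚ.<⇒≤ 0<η) K≤K+1 ⟩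
  η ℚ.* (K ℚ.+ 1ℚ)     ≡⟨ ℚₚ.*-assoc ε _ (K ℚ.+ 1ℚ) ⟩
  ε ℚ.* (ℚ.1/_ (K ℚ.+ 1ℚ) {{nz}} ℚ.* (K ℚ.+ 1ℚ)) ≡⟨ cong (ε ℚ.*_) (ℚₚ.*-inverseˡ (K ℚ.+ 1ℚ) {{nz}}) ⟩
  ε ℚ.* 1ℚ             ≡⟨ ℚₚ.*-identityʳ ε ⟩
  ε                    ∎)
  where
  open ℚₚ.≤-Reasoning
  K≤K+1 : K ℚ.≤ K ℚ.+ 1ℚ
  K≤K+1 = subst (ℚ._≤ K ℚ.+ 1ℚ) (ℚₚ.+-identityʳ K) (ℚₚ.+-monoʳ-≤ K (ℚₚ.nonNegative⁻¹ 1ℚ))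
  pos : ℚ.Positive (K ℚ.+ 1ℚ)
  pos = ℚₚ.nonNeg+pos⇒pos K {{ℚ.nonNegative 0≤K}} 1ℚ
  nz : ℚ.NonZero (K ℚ.+ 1ℚ)
  nz = ℚₚ.pos⇒nonZero (K ℚ.+ 1ℚ) {{pos}}
  η : ℚ
  -- Dividing by K + 1 rather than by K covers K = 0.
  η = ε ℚ.* ℚ.1/_ (K ℚ.+ 1ℚ) {{nz}}
  0<η : 0ℚ ℚ.< η
  0<η = ℚₚ.positive⁻¹ η {{ℚₚ.pos*pos⇒pos ε {{ℚ.positive 0<ε}} _ {{ℚₚ.1/pos⇒pos (K ℚ.+ 1ℚ) {{pos}}}}}}

∑-concat-map : ∀ {A B : Set} (h : A → List B) xs (f : B → ℚ) → ∑ (concat (map h xs)) f ≡ ∑ xs (λ a → ∑ (h a) f)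
∑-concat-map h []       f = refl
∑-concat-map h (x ∷ xs) f = trans (∑-++ (h x) _ f) (cong (∑ (h x) f ℚ.+_) (∑-concat-map h xs f))

-- Search downwards: a bound that fails `Q` can be lowered by one, and `Q 0` stops the search.
bounded-maximum : {Q : ℕ → Set} → (∀ k → Dec (Q k)) → Q 0 → ∀ B → (∀ k → Q k → k ℕ.≤ B) → ∃ (IsMaximum ℕ._≤_ Q)
bounded-maximum Q? q₀ zero    bound = 0 , q₀ , bound
bounded-maximum Q? q₀ (suc B) bound with Q? (suc B)
... | yes q = suc B , q , bound
... | no ¬q = bounded-maximum Q? q₀ B λ k q → ℕₚ.≤-pred (ℕₚ.≤∧≢⇒< (bound k q) λ { refl → ¬q q })

-- The finite search space for a packing of a given size.
words : ∀ {A : Set} → List A → ℕ → List (List A)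
words xs zero    = [] ∷ []
words xs (suc k) = cartesianProductWith _∷_ xs (words xs k)

∈-words : ∀ {A : Set} {xs : List A} → (∀ a → a ∈ xs) → ∀ w → w ∈ words xs (length w)
∈-words ∈xs []      = here refl
∈-words ∈xs (a ∷ w) = ∈-cartesianProductWith⁺ _∷_ (∈xs a) (∈-words ∈xs w)

disjoint? : ∀ {A : Set} → DecidableEquality A → (xs ys : List A) → Dec (Disjoint xs ys)
disjoint? _≟_ xs ys = map′ (λ h (v∈xs , v∈ys) → All.lookup h v∈xs v∈ys) (λ h → All.tabulate λ v∈xs v∈ys → h (v∈xs , v∈ys))
  (All.all? (λ v → ¬? (v ∈? ys)) xs)
  where open DecMembership _≟_ using (_∈?_)

module Optimisation {r : ℕ} (H : OrderedHypergraph r) {e₀ : Embedding r (order H)} (e₀∈ : e₀ ∈ edges H) (n : ℕ) where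

  open import Data.Rational using (_+_; _*_; _-_; -_; _≤_)
  open ℚSolver.+-*-Solver using (solve; _:+_; _:*_; _:-_; _:=_; con)
  open DecMembership (_≟ᴱ_ {r} {n}) using (_∈?_)

  private
    as : List (Copy n H)
    as = copies n H
    bs : List (KEdge r n)
    bs = embeddings r n

  incidence : KEdge r n → Copy n H → ℚ
  incidence e f = 𝟙 (e ∈? copyEdges n H f)

  open Duality _≟ᴱ_ _≟ᴱ_ as (embeddings-unique (order H) n) ∈-embeddings bs (embeddings-unique r n) ∈-embeddings incidence public

  copyEdges-unique : ∀ f → Unique (copyEdges n H f)
  copyEdges-unique f = Uniqueₚ.map⁺ (⊙-injective f) (Uniqueₚ.filter⁺ (edge? H) (embeddings-unique r (order H)))

  load≡ : ∀ x e → load x e ≡ ∑ (copiesContaining n H e) x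
  load≡ x e = sym (∑-filter (λ f → e ∈? copyEdges n H f) as x)

  cover≡ : ∀ y f → cover y f ≡ ∑ (copyEdges n H f) y
  cover≡ y f = sym (∑-restrict _≟ᴱ_ (copyEdges-unique f) (embeddings-unique r n) (λ {e} _ → ∈-embeddings e) y)

  0≤1 : 0ℚ ≤ 1ℚ
  0≤1 = ℚₚ.nonNegative⁻¹ 1ℚ

  -- The edge `e₀` of H enters here: every copy has an edge, so the transversal program has a
  -- feasible point from which duality can start.
  unit-covers : ∀ f → 1ℚ ≤ cover (const 1ℚ) f
  unit-covers f = subst (1ℚ ≤_) (sym (cover≡ (const 1ℚ) f)) (term≤∑ {a = f ⊙ e₀} (λ _ → 0≤1) (∈-map⁺ (f ⊙_) e₀∈))

  abstract
    optimum : Optimum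
    optimum = strong-duality {const 1ℚ} (λ _ → 0≤1) unit-covers

  open Optimum optimum public

  optimalValue : ℚ
  optimalValue = ∑ as x

  0≤optimalValue : 0ℚ ≤ optimalValue
  0≤optimalValue = ∑-nonNeg as 0≤x

  optimalValue≤ : ∀ {w} → (∀ e → 0ℚ ≤ w e) → (∀ f → 1ℚ ≤ ∑ (copyEdges n H f) w) → optimalValue ≤ ∑ bs w
  optimalValue≤ {w} 0≤w covers = subst₂ _≤_ (ℚₚ.*-identityˡ (∑ as x)) (ℚₚ.*-identityˡ (∑ bs w))
    (weak-duality 0≤x 0≤w load≤1 (λ f → subst (1ℚ ≤_) (sym (cover≡ w f)) (covers f)))

  -- The copies are edge-disjoint, so their edge lists concatenate to a list without repetition, and
  -- their weights, each at least 1, add up inside the total of `w`.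
  packing≤ : ∀ {p w} → IsPacking n H p → (∀ e → 0ℚ ≤ w e) → (∀ f → 1ℚ ≤ cover w f) → ι (length p) ≤ ∑ bs w
  packing≤ {p} {w} packing 0≤w covers = begin
    ι (length p)                             ≡⟨ trans (∑-const p 1ℚ) (ℚₚ.*-identityʳ (ι (length p))) ⟨
    ∑ p (const 1ℚ)                           ≤⟨ ∑-mono p (λ {f} _ → subst (1ℚ ≤_) (cover≡ w f) (covers f)) ⟩
    ∑ p (λ f → ∑ (copyEdges n H f) w)        ≡⟨ ∑-concat-map (copyEdges n H) p w ⟨
    ∑ (concat (map (copyEdges n H) p)) w
      ≤⟨ ∑-⊆ _≟ᴱ_ edges! (embeddings-unique r n) (λ {e} _ → ∈-embeddings e) 0≤w ⟩
    ∑ bs w                                   ∎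
    where
    open ℚₚ.≤-Reasoning
    edges! : Unique (concat (map (copyEdges n H) p))
    edges! = Uniqueₚ.concat⁺ (Allₚ.map⁺ (All.universal copyEdges-unique p)) (AllPairsₚ.map⁺ (AllPairs.map proj₂ packing))

  isPacking? : ∀ p → Dec (IsPacking n H p)
  isPacking? = AllPairs.allPairs? λ f g → ¬? (f ≟ᴱ g) ×-dec disjoint? _≟ᴱ_ (copyEdges n H f) (copyEdges n H g)

  ν-exists : ∃ (Isν n H)
  ν-exists = bounded-maximum packable? ([] , [] , refl) (length bs) bound
    where
    packable? : ∀ k → Dec (∃ λ p → IsPacking n H p × length p ≡ k)
    packable? k = map′ (λ any → let p , _ , h = find any in p , h)
      (λ { (p , h , refl) → lose (∈-words ∈-embeddings p) (h , refl) })
      (any? (λ p → isPacking? p ×-dec (length p ℕ.≟ k)) (words as k))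
    -- The constant weight 1 is a transversal, so it limits every packing by the number of edges.
    bound : ∀ k → (∃ λ p → IsPacking n H p × length p ≡ k) → k ℕ.≤ length bs
    bound _ (p , packing , refl) = ι-cancel (subst (ι (length p) ≤_) (trans (∑-const bs 1ℚ) (ℚₚ.*-identityʳ (ι (length bs))))
      (packing≤ packing (λ _ → 0≤1) unit-covers))

  ν≤optimalValue : ∀ {k} → Isν n H k → ι k ≤ optimalValue
  ν≤optimalValue ((p , packing , refl) , _) = subst (ι (length p) ≤_) (sym values-agree) (packing≤ packing 0≤y 1≤cover)

  -- One stage of a real packing: adding η makes the weights nonnegative and raises each load to at
  -- most 1 + η + l η, with l the number of copies. Weak duality against the optimal `y` then gives
  -- the factor in the hypothesis on η.
  packing-bound : ∀ {w η ε} → 0ℚ ≤ η → η * ((1ℚ + ι (length as)) * optimalValue) ≤ ε →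
    (∀ f → 0ℚ ≤ w f + η) → (∀ e → ∑ (copiesContaining n H e) w ≤ 1ℚ + η) → ∑ as w ≤ optimalValue + ε
  packing-bound {w} {η} {ε} 0≤η ηK≤ε nonneg capacity = begin
    ∑ as w
      ≤⟨ ∑-mono as (λ {f} _ → subst (_≤ w f + η) (ℚₚ.+-identityʳ (w f)) (ℚₚ.+-monoʳ-≤ (w f) 0≤η)) ⟩
    ∑ as w′                      ≡⟨ ℚₚ.*-identityˡ (∑ as w′) ⟨
    1ℚ * ∑ as w′                 ≤⟨ weak-duality {w′} {y} nonneg 0≤y load-w′≤ 1≤cover ⟩
    (1ℚ + η + l * η) * ∑ bs y    ≡⟨ cong ((1ℚ + η + l * η) *_) values-agree ⟨
    (1ℚ + η + l * η) * v
      ≡⟨ solve 3 (λ d l v → (con 1ℚ :+ d :+ l :* d) :* v := v :+ d :* ((con 1ℚ :+ l) :* v)) refl η l v ⟩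
    v + η * ((1ℚ + l) * v)       ≤⟨ ℚₚ.+-monoʳ-≤ v ηK≤ε ⟩
    v + ε                        ∎
    where
    open ℚₚ.≤-Reasoning
    l v : ℚ
    l = ι (length as)
    v = optimalValue
    w′ : Copy n H → ℚ
    w′ f = w f + η
    load-w′≤ : ∀ e → load w′ e ≤ 1ℚ + η + l * η
    load-w′≤ e = begin
      load w′ e
        ≡⟨ ∑-cong as (λ {f} _ → ℚₚ.*-distribˡ-+ (incidence e f) (w f) η) ⟩
      ∑ as (λ f → incidence e f * w f + incidence e f * η)
                                                  ≡⟨ ∑-+ as (λ f → incidence e f * w f) (λ f → incidence e f * η) ⟩
      load w e + ∑ as (λ f → incidence e f * η)   ≤⟨ ℚₚ.+-mono-≤ (subst (_≤ 1ℚ + η) (sym (load≡ w e)) (capacity e))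
                                                       (∑-mono as λ {f} _ → *-monoʳ 0≤η (𝟙≤1 (e ∈? copyEdges n H f))) ⟩
      1ℚ + η + ∑ as (const (1ℚ * η))
        ≡⟨ cong (1ℚ + η +_) (trans (∑-const as (1ℚ * η)) (cong (l *_) (ℚₚ.*-identityˡ η))) ⟩
      1ℚ + η + l * η                              ∎

  -- Adding η makes the weights nonnegative and leaves every cover at least 1 - η, so weak duality
  -- applies with the optimal `x`. The raised total costs l η, with l the number of edges, and the
  -- weaker cover costs η times the optimal value.
  transversal-bound : ∀ {w η ε} → 0ℚ ≤ η → η * (ι (length bs) + optimalValue) ≤ ε →
    (∀ e → 0ℚ ≤ w e + η) → (∀ f → 1ℚ ≤ ∑ (copyEdges n H f) w + η) → optimalValue ≤ ∑ bs w + ε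
  transversal-bound {w} {η} {ε} 0≤η ηK≤ε nonneg covers = begin
    v                                ≡⟨ solve 2 (λ d v → v := (con 1ℚ :- d) :* v :+ d :* v) refl η v ⟩
    (1ℚ - η) * v + η * v             ≤⟨ ℚₚ.+-monoˡ-≤ (η * v) (weak-duality {x} {w′} 0≤x nonneg load≤1 ≤cover-w′) ⟩
    1ℚ * ∑ bs w′ + η * v
      ≡⟨ cong (λ a → 1ℚ * a + η * v) (trans (∑-+ bs w (const η)) (cong (∑ bs w +_) (∑-const bs η))) ⟩
    1ℚ * (∑ bs w + l * η) + η * v
      ≡⟨ solve 4 (λ s l d v → con 1ℚ :* (s :+ l :* d) :+ d :* v := s :+ d :* (l :+ v)) refl (∑ bs w) l η v ⟩
    ∑ bs w + η * (l + v)             ≤⟨ ℚₚ.+-monoʳ-≤ (∑ bs w) ηK≤ε ⟩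
    ∑ bs w + ε                       ∎
    where
    open ℚₚ.≤-Reasoning
    l v : ℚ
    l = ι (length bs)
    v = optimalValue
    w′ : KEdge r n → ℚ
    w′ e = w e + η
    ≤cover-w′ : ∀ f → 1ℚ - η ≤ cover w′ f
    ≤cover-w′ f = begin
      1ℚ - η                             ≤⟨ ℚₚ.+-monoˡ-≤ (- η) (covers f) ⟩
      ∑ (copyEdges n H f) w + η - η      ≡⟨ solve 2 (λ s d → s :+ d :- d := s) refl (∑ (copyEdges n H f) w) η ⟩
      ∑ (copyEdges n H f) w
        ≤⟨ ∑-mono (copyEdges n H f) (λ {e} _ → subst (_≤ w e + η) (ℚₚ.+-identityʳ (w e)) (ℚₚ.+-monoʳ-≤ (w e) 0≤η)) ⟩
      ∑ (copyEdges n H f) w′             ≡⟨ cover≡ w′ f ⟨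
      cover w′ f                         ∎

  fractionalPacking≤ : ∀ {w} → IsFractionalPacking n H w → sumOver as w ≤ℝ fromℚ optimalValue
  fractionalPacking≤ {w} (0≤w , w≤1) ε 0<ε =
    -- The factor of η depends only on n and H, so η is fixed before the stage of the sequences is
    -- chosen.
    let η , 0<η , ηK≤ε = small (*-nonNeg (+-nonNeg 0≤1 (0≤ι (length as))) 0≤optimalValue) 0<ε
        M , p = eventually-all as (λ f → 0≤w f η 0<η)
        N , q = eventually-all bs (λ e → w≤1 e η 0<η)
    in M ℕ.⊔ N , λ k h → subst (_≤ optimalValue + ε) (sym (seq-sumOver as w k))
      (packing-bound {λ f → seq (w f) k} (ℚₚ.<⇒≤ 0<η) ηK≤ε
        (λ f → p k (ℕₚ.m⊔n≤o⇒m≤o M N h) (∈-embeddings f))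
        (λ e → subst (_≤ 1ℚ + η) (seq-sumOver (copiesContaining n H e) w k) (q k (ℕₚ.m⊔n≤o⇒n≤o M N h) (∈-embeddings e))))

  ≤fractionalTransversal : ∀ {w} → IsFractionalTransversal n H w → fromℚ optimalValue ≤ℝ sumOver bs w
  ≤fractionalTransversal {w} (0≤w , 1≤w) ε 0<ε =
    let η , 0<η , ηK≤ε = small (+-nonNeg (0≤ι (length bs)) 0≤optimalValue) 0<ε
        M , p = eventually-all bs (λ e → 0≤w e η 0<η)
        N , q = eventually-all as (λ f → 1≤w f η 0<η)
    in M ℕ.⊔ N , λ k h → subst (λ a → optimalValue ≤ a + ε) (sym (seq-sumOver bs w k))
      (transversal-bound {λ e → seq (w e) k} (ℚₚ.<⇒≤ 0<η) ηK≤ε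
        (λ e → p k (ℕₚ.m⊔n≤o⇒m≤o M N h) (∈-embeddings e))
        (λ f → subst (λ a → 1ℚ ≤ a + η) (seq-sumOver (copyEdges n H f) w k) (q k (ℕₚ.m⊔n≤o⇒n≤o M N h) (∈-embeddings f))))

  ν*-optimalValue : Isν* n H (fromℚ optimalValue)
  ν*-optimalValue =
    ((fromℚ ∘ x) ,
      ((λ f → ≤⇒≤ℝ {0ℝ} {fromℚ (x f)} (λ _ → 0≤x f)) ,
       (λ e → ≤⇒≤ℝ {sumOver (copiesContaining n H e) (fromℚ ∘ x)} {1ℝ} λ k →
         subst (_≤ 1ℚ) (trans (load≡ x e) (sym (seq-sumOver (copiesContaining n H e) (fromℚ ∘ x) k))) (load≤1 e))) ,
      ≤⇒≤ℝ {sumOver as (fromℚ ∘ x)} {fromℚ optimalValue} (λ k → ℚₚ.≤-reflexive (seq-sumOver as (fromℚ ∘ x) k)) ,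
      ≤⇒≤ℝ {fromℚ optimalValue} {sumOver as (fromℚ ∘ x)} (λ k → ℚₚ.≤-reflexive (sym (seq-sumOver as (fromℚ ∘ x) k)))) ,
    λ u (w , packing , _ , u≤) → ≤ℝ-trans {u} {sumOver as w} {fromℚ optimalValue} u≤ (fractionalPacking≤ {w} packing)

  τ*-optimalValue : Isτ* n H (fromℚ optimalValue)
  τ*-optimalValue =
    ((fromℚ ∘ y) ,
      ((λ e → ≤⇒≤ℝ {0ℝ} {fromℚ (y e)} (λ _ → 0≤y e)) ,
       (λ f → ≤⇒≤ℝ {1ℝ} {sumOver (copyEdges n H f) (fromℚ ∘ y)} λ k →
         subst (1ℚ ≤_) (trans (cover≡ y f) (sym (seq-sumOver (copyEdges n H f) (fromℚ ∘ y) k))) (1≤cover f))) ,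
      ≤⇒≤ℝ {sumOver bs (fromℚ ∘ y)} {fromℚ optimalValue} (λ k → ℚₚ.≤-reflexive (trans (seq-sumOver bs (fromℚ ∘ y) k) (sym values-agree))) ,
      ≤⇒≤ℝ {fromℚ optimalValue} {sumOver bs (fromℚ ∘ y)} (λ k → ℚₚ.≤-reflexive (trans values-agree (sym (seq-sumOver bs (fromℚ ∘ y) k))))) ,
    λ u (w , transversal , ≤u , _) → ≤ℝ-trans {fromℚ optimalValue} {sumOver bs w} {u} (≤fractionalTransversal {w} transversal) ≤u

-- Binomial asymptotics

module _ where

  open import Data.Nat using (_+_; _*_; _∸_; _^_; _≤_; _<_; _/_)
  open ℕSolver.+-*-Solver using (solve; _:+_; _:*_; _:=_; con)

  absorption : ∀ n k → suc k * (suc n C suc k) ≡ suc n * (n C k)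
  absorption zero    zero    = refl
  absorption zero    (suc k) = ℕₚ.*-zeroʳ k
  absorption (suc n) zero    = trans (ℕₚ.*-identityˡ (suc (suc n) C 1)) (trans (nC1≡n (suc (suc n))) (sym (ℕₚ.*-identityʳ (suc (suc n)))))
  absorption (suc n) (suc k) = begin
    suc (suc k) * (suc (suc n) C suc (suc k))
      ≡⟨ cong (suc (suc k) *_) (nCk+nC[k+1]≡[n+1]C[k+1] (suc n) (suc k)) ⟨
    suc (suc k) * (A + B)
      ≡⟨ solve 3 (λ k a b → (con 2 :+ k) :* (a :+ b) := a :+ ((con 1 :+ k) :* a :+ (con 2 :+ k) :* b)) refl k A B ⟩
    A + (suc k * A + suc (suc k) * B)
      ≡⟨ cong (A +_) (cong₂ _+_ (absorption n k) (absorption n (suc k))) ⟩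
    A + (suc n * (n C k) + suc n * (n C suc k))
      ≡⟨ cong (A +_) (ℕₚ.*-distribˡ-+ (suc n) (n C k) (n C suc k)) ⟨
    A + suc n * (n C k + n C suc k)
      ≡⟨ cong (λ b → A + suc n * b) (nCk+nC[k+1]≡[n+1]C[k+1] n k) ⟩
    suc (suc n) * A ∎
    where
    open ≡-Reasoning
    A B : ℕ
    A = suc n C suc k
    B = suc n C suc (suc k)

  !*C-suc : ∀ n k → suc k ! * (suc n C suc k) ≡ suc n * (k ! * (n C k))
  !*C-suc n k = begin
    (suc k * k !) * (suc n C suc k)
      ≡⟨ solve 3 (λ a b c → (a :* b) :* c := b :* (a :* c)) refl (suc k) (k !) (suc n C suc k) ⟩
    k ! * (suc k * (suc n C suc k))  ≡⟨ cong (k ! *_) (absorption n k) ⟩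
    k ! * (suc n * (n C k))
      ≡⟨ solve 3 (λ a b c → a :* (b :* c) := b :* (a :* c)) refl (k !) (suc n) (n C k) ⟩
    suc n * (k ! * (n C k))          ∎
    where open ≡-Reasoning

  !*C≤^ : ∀ n k → k ! * (n C k) ≤ n ^ k
  !*C≤^ n       zero    = ℕₚ.≤-refl
  !*C≤^ zero    (suc k) = ℕₚ.≤-reflexive (ℕₚ.*-zeroʳ (suc k !))
  !*C≤^ (suc n) (suc k) = begin
    suc k ! * (suc n C suc k)  ≡⟨ !*C-suc n k ⟩
    suc n * (k ! * (n C k))    ≤⟨ ℕₚ.*-monoʳ-≤ (suc n) (!*C≤^ n k) ⟩
    suc n * n ^ k              ≤⟨ ℕₚ.*-monoʳ-≤ (suc n) (ℕₚ.^-monoˡ-≤ k (ℕₚ.n≤1+n n)) ⟩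
    suc n * suc n ^ k          ∎
    where open ℕₚ.≤-Reasoning

  -- The right-hand side is the product (n + 1)...(n + k). The shift by k replaces the usual lower
  -- bound (n - k + 1)^k, which would involve truncated subtraction.
  ^≤!*C : ∀ n k → n ^ k ≤ k ! * ((n + k) C k)
  ^≤!*C n zero    = ℕₚ.≤-refl
  ^≤!*C n (suc k) = begin
    n * n ^ k                          ≤⟨ ℕₚ.*-mono-≤ (ℕₚ.≤-trans (ℕₚ.m≤m+n n k) (ℕₚ.n≤1+n (n + k))) (^≤!*C n k) ⟩
    suc (n + k) * (k ! * ((n + k) C k)) ≡⟨ !*C-suc (n + k) k ⟨
    suc k ! * (suc (n + k) C suc k)    ≡⟨ cong (λ a → suc k ! * (a C suc k)) (ℕₚ.+-suc n k) ⟨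
    suc k ! * ((n + suc k) C suc k)    ∎
    where open ℕₚ.≤-Reasoning

  -- With denominators cleared, this is (1 + a/x)^r ≤ 1 + K/x for x ≥ 1: a further factor 1 + a/x
  -- brings the error to (a + K)/x + aK/x^2, and 1/x^2 ≤ 1/x.
  ^-linear-error : ∀ a r → ∃ λ K → ∀ x .{{_ : NonZero x}} → (x + a) ^ r * x ≤ x ^ r * (x + K)
  ^-linear-error a zero    = 0 , λ x → ℕₚ.≤-reflexive (cong (1 *_) (sym (ℕₚ.+-identityʳ x)))
  ^-linear-error a (suc r) with ^-linear-error a r
  ... | K , h = a + K + a * K , λ x → begin
    (x + a) * (x + a) ^ r * x               ≡⟨ ℕₚ.*-assoc (x + a) ((x + a) ^ r) x ⟩
    (x + a) * ((x + a) ^ r * x)             ≤⟨ ℕₚ.*-monoʳ-≤ (x + a) (h x) ⟩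
    (x + a) * (x ^ r * (x + K))
      ≡⟨ solve 4 (λ x a p k → (x :+ a) :* (p :* (x :+ k)) := p :* (x :* (x :+ (a :+ k)) :+ a :* k)) refl x a (x ^ r) K ⟩
    x ^ r * (x * (x + (a + K)) + a * K)
      ≤⟨ ℕₚ.*-monoʳ-≤ (x ^ r) (ℕₚ.+-monoʳ-≤ (x * (x + (a + K))) (ℕₚ.m≤n*m (a * K) x)) ⟩
    x ^ r * (x * (x + (a + K)) + x * (a * K))
      ≡⟨ solve 5 (λ x a p k q → p :* (x :* (x :+ (a :+ k)) :+ x :* q) := x :* p :* (x :+ (a :+ k :+ q))) refl x a (x ^ r) K (a * K) ⟩
    x * x ^ r * (x + (a + K + a * K))       ∎
    where open ℕₚ.≤-Reasoning

  -- The asymptotic equality of (x + a)^r and x^r, with relative error 1/k and without division. By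
  -- `^-linear-error` the relative error is at most K/x, which is small enough once x exceeds k K.
  ^-shift-asymptotic : ∀ a r k → ∃ λ N → ∀ x → N ≤ x → k * (x + a) ^ r ≤ suc k * x ^ r
  ^-shift-asymptotic a r k with ^-linear-error a r
  ... | K , h = suc (k * K) , bound
    where
    open ℕₚ.≤-Reasoning
    bound : ∀ x → suc (k * K) ≤ x → k * (x + a) ^ r ≤ suc k * x ^ r
    bound x@(suc _) (s≤s kK≤x-1) = ℕₚ.*-cancelʳ-≤ (k * (x + a) ^ r) (suc k * x ^ r) x (begin
      k * (x + a) ^ r * x        ≡⟨ ℕₚ.*-assoc k ((x + a) ^ r) x ⟩
      k * ((x + a) ^ r * x)      ≤⟨ ℕₚ.*-monoʳ-≤ k (h x) ⟩
      k * (x ^ r * (x + K))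
        ≡⟨ solve 4 (λ k p x K → k :* (p :* (x :+ K)) := p :* (k :* x :+ k :* K)) refl k (x ^ r) x K ⟩
      x ^ r * (k * x + k * K)    ≤⟨ ℕₚ.*-monoʳ-≤ (x ^ r) (ℕₚ.+-monoʳ-≤ (k * x) (ℕₚ.m≤n⇒m≤1+n kK≤x-1)) ⟩
      x ^ r * (k * x + x)
        ≡⟨ solve 3 (λ k p x → p :* (k :* x :+ x) := (con 1 :+ k) :* p :* x) refl k (x ^ r) x ⟩
      suc k * x ^ r * x          ∎)

  ^-distrib-* : ∀ a b k → (a * b) ^ k ≡ a ^ k * b ^ k
  ^-distrib-* a b zero    = refl
  ^-distrib-* a b (suc k) = trans (cong (a * b *_) (^-distrib-* a b k))
    (solve 4 (λ a b p q → a :* b :* (p :* q) := a :* p :* (b :* q)) refl a b (a ^ k) (b ^ k))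

  module _ (t : ℕ) .{{_ : NonZero t}} where

    n≤t+t*[n/t] : ∀ n → n ≤ t + t * (n / t)
    n≤t+t*[n/t] n = begin
      n                     ≡⟨ m≡m%n+[m/n]*n n t ⟩
      n % t + n / t * t     ≤⟨ ℕₚ.+-monoˡ-≤ (n / t * t) (ℕₚ.<⇒≤ (m%n<n n t)) ⟩
      t + n / t * t         ≡⟨ cong (t +_) (ℕₚ.*-comm (n / t) t) ⟩
      t + t * (n / t)       ∎
      where open ℕₚ.≤-Reasoning

    n≤t*[1+n/t] : ∀ n → n ≤ t * suc (n / t)
    n≤t*[1+n/t] n = ℕₚ.≤-trans (n≤t+t*[n/t] n) (ℕₚ.≤-reflexive (sym (ℕₚ.*-suc t (n / t))))

    t*[n/t]≤n : ∀ n → t * (n / t) ≤ n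
    t*[n/t]≤n n = ℕₚ.≤-trans (ℕₚ.≤-reflexive (ℕₚ.*-comm t (n / t))) (m/n*n≤m n t)

    C-floor-asymptotic : ∀ r k → ∃ λ N → ∀ n → N ≤ n → k * (n C r) ≤ suc k * (t ^ r * ((n / t) C r))
    -- With M = n / t - r, n is at most t + t(M + r), so it exceeds t M by at most t r + t.
    C-floor-asymptotic r k with ^-shift-asymptotic (t * r + t) r k
    ... | N , h = (N + r) * t , λ n N≤n → bound n (ℕₚ.≤-trans (ℕₚ.≤-reflexive (sym (m*n/n≡m (N + r) t))) (/-monoˡ-≤ t N≤n))
      where
      open ℕₚ.≤-Reasoning
      bound : ∀ n → N + r ≤ n / t → k * (n C r) ≤ suc k * (t ^ r * ((n / t) C r))
      bound n N+r≤ = ℕₚ.*-cancelˡ-≤ (r !) {{r ℕₚ.!≢0}} (begin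
        r ! * (k * (n C r))
          ≡⟨ solve 3 (λ f k c → f :* (k :* c) := k :* (f :* c)) refl (r !) k (n C r) ⟩
        k * (r ! * (n C r))                ≤⟨ ℕₚ.*-monoʳ-≤ k (!*C≤^ n r) ⟩
        k * n ^ r                          ≤⟨ ℕₚ.*-monoʳ-≤ k (ℕₚ.^-monoˡ-≤ r n≤) ⟩
        k * (t * M + (t * r + t)) ^ r      ≤⟨ h (t * M) (ℕₚ.≤-trans N≤M (ℕₚ.m≤n*m M t)) ⟩
        suc k * (t * M) ^ r                ≡⟨ cong (suc k *_) (^-distrib-* t M r) ⟩
        suc k * (t ^ r * M ^ r)            ≤⟨ ℕₚ.*-monoʳ-≤ (suc k) (ℕₚ.*-monoʳ-≤ (t ^ r) (^≤!*C M r)) ⟩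
        suc k * (t ^ r * (r ! * ((M + r) C r))) ≡⟨ cong (λ a → suc k * (t ^ r * (r ! * (a C r)))) M+r≡ ⟩
        suc k * (t ^ r * (r ! * ((n / t) C r)))
          ≡⟨ solve 4 (λ k p f c → k :* (p :* (f :* c)) := f :* (k :* (p :* c))) refl (suc k) (t ^ r) (r !) ((n / t) C r) ⟩
        r ! * (suc k * (t ^ r * ((n / t) C r))) ∎)
        where
        M : ℕ
        M = n / t ∸ r
        M+r≡ : M + r ≡ n / t
        M+r≡ = ℕₚ.m∸n+n≡m (ℕₚ.≤-trans (ℕₚ.m≤n+m r N) N+r≤)
        N≤M : N ≤ M
        N≤M = ℕₚ.m+n≤o⇒m≤o∸n N N+r≤
        n≤ : n ≤ t * M + (t * r + t)
        n≤ = begin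
          n                       ≤⟨ n≤t+t*[n/t] n ⟩
          t + t * (n / t)         ≡⟨ cong (λ a → t + t * a) M+r≡ ⟨
          t + t * (M + r)         ≡⟨ solve 3 (λ t M r → t :+ t :* (M :+ r) := t :* M :+ (t :* r :+ t)) refl t M r ⟩
          t * M + (t * r + t)     ∎

    C-ceiling-asymptotic : ∀ r k → ∃ λ N → ∀ n → N ≤ n → k * (t ^ r * (suc (n / t) C r)) ≤ suc k * (n C r)
    -- Here n = M + r and t(1 + n / t) ≤ t + n, so the excess over M is at most r + t.
    C-ceiling-asymptotic r k with ^-shift-asymptotic (r + t) r k
    ... | N , h = N + r , λ n N+r≤n → ℕₚ.*-cancelˡ-≤ (r !) {{r ℕₚ.!≢0}} (bound n (n ∸ r)
          (ℕₚ.m∸n+n≡m (ℕₚ.≤-trans (ℕₚ.m≤n+m r N) N+r≤n)) (ℕₚ.m+n≤o⇒m≤o∸n N N+r≤n))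
      where
      open ℕₚ.≤-Reasoning
      bound : ∀ n M → M + r ≡ n → N ≤ M → r ! * (k * (t ^ r * (suc (n / t) C r))) ≤ r ! * (suc k * (n C r))
      bound n M refl N≤M = begin
        r ! * (k * (t ^ r * (suc (n / t) C r)))
          ≡⟨ solve 4 (λ k p f c → f :* (k :* (p :* c)) := k :* (p :* (f :* c))) refl k (t ^ r) (r !) (suc (n / t) C r) ⟩
        k * (t ^ r * (r ! * (suc (n / t) C r)))
          ≤⟨ ℕₚ.*-monoʳ-≤ k (ℕₚ.*-monoʳ-≤ (t ^ r) (!*C≤^ (suc (n / t)) r)) ⟩
        k * (t ^ r * suc (n / t) ^ r)             ≡⟨ cong (k *_) (^-distrib-* t (suc (n / t)) r) ⟨
        k * (t * suc (n / t)) ^ r                 ≤⟨ ℕₚ.*-monoʳ-≤ k (ℕₚ.^-monoˡ-≤ r t*≤) ⟩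
        k * (M + (r + t)) ^ r                     ≤⟨ h M N≤M ⟩
        suc k * M ^ r                             ≤⟨ ℕₚ.*-monoʳ-≤ (suc k) (^≤!*C M r) ⟩
        suc k * (r ! * (n C r))
          ≡⟨ solve 3 (λ k f c → k :* (f :* c) := f :* (k :* c)) refl (suc k) (r !) (n C r) ⟩
        r ! * (suc k * (n C r))                   ∎
        where
        t*≤ : t * suc (n / t) ≤ M + (r + t)
        t*≤ = begin
          t * suc (n / t)    ≡⟨ ℕₚ.*-suc t (n / t) ⟩
          t + t * (n / t)    ≤⟨ ℕₚ.+-monoʳ-≤ t (t*[n/t]≤n n) ⟩
          t + (M + r)        ≡⟨ solve 3 (λ t M r → t :+ (M :+ r) := M :+ (r :+ t)) refl t M r ⟩
          M + (r + t)        ∎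

-- From integer inequalities to rational error terms

module _ where

  open import Data.Rational using (_+_; _*_; _-_; -_; _≤_; _<_)
  open ℚSolver.+-*-Solver using (solve; _:+_; _:*_; _:-_; _:=_; con)
  open RawSemiring ℚ.+-*-rawSemiring using (_^_)

  ι*[d/td] : ∀ t d .{{_ : NonZero t}} .{{_ : NonZero d}} .{{_ : NonZero (t ℕ.* d)}} → ι t * (ℤ.+ d ℚ./ (t ℕ.* d)) ≡ 1ℚ
  ι*[d/td] t@(suc t′) d@(suc d′) = ℚₚ.toℚᵘ-injective (begin
    ℚ.toℚᵘ (ι t * (ℤ.+ d ℚ./ (t ℕ.* d)))               ≈⟨ ℚₚ.toℚᵘ-homo-* (ι t) (ℤ.+ d ℚ./ (t ℕ.* d)) ⟩
    ℚ.toℚᵘ (ι t) ℚᵘ.* ℚ.toℚᵘ (ℤ.+ d ℚ./ (t ℕ.* d))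
      ≈⟨ ℚᵘₚ.*-cong (toℚᵘ-ι t) (ℚₚ.toℚᵘ-fromℚᵘ (mkℚᵘ (ℤ.+ d) (d′ ℕ.+ t′ ℕ.* d))) ⟩
    mkℚᵘ (ℤ.+ t) 0 ℚᵘ.* mkℚᵘ (ℤ.+ d) (d′ ℕ.+ t′ ℕ.* d)
      ≈⟨ ℚᵘ.*≡* (trans (ℤₚ.*-identityʳ _) (trans (sym (ℤₚ.pos-* t d))
                                                            (sym (trans (ℤₚ.*-identityˡ _) (cong ℤ.+_ (ℕₚ.*-identityˡ (t ℕ.* d))))))) ⟩
    mkℚᵘ (ℤ.+ 1) 0                                     ∎)
    where open ℚᵘₚ.≃-Reasoning

  ι^*^ : ∀ t p → ι t * p ≡ 1ℚ → ∀ k → ι (t ℕ.^ k) * p ^ k ≡ 1ℚ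
  ι^*^ t p tp≡1 zero    = refl
  ι^*^ t p tp≡1 (suc k) = begin
    ι (t ℕ.* t ℕ.^ k) * (p * p ^ k)     ≡⟨ cong (_* (p * p ^ k)) (ι-* t (t ℕ.^ k)) ⟩
    ι t * ι (t ℕ.^ k) * (p * p ^ k)
      ≡⟨ solve 4 (λ a b c d → a :* b :* (c :* d) := (a :* c) :* (b :* d)) refl (ι t) (ι (t ℕ.^ k)) p (p ^ k) ⟩
    (ι t * p) * (ι (t ℕ.^ k) * p ^ k)   ≡⟨ cong₂ _*_ tp≡1 (ι^*^ t p tp≡1 k) ⟩
    1ℚ * 1ℚ                             ∎
    where open ≡-Reasoning

  ^-nonNeg : ∀ {p} → 0ℚ ≤ p → ∀ k → 0ℚ ≤ p ^ k
  ^-nonNeg 0≤p zero    = ℚₚ.nonNegative⁻¹ 1ℚ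
  ^-nonNeg 0≤p (suc k) = *-nonNeg 0≤p (^-nonNeg 0≤p k)

  -- For ε = (a + 1)/(b + 1), multiplication by b + 1 gives a + 1 ≥ 1, so k = b.
  archimedean : ∀ ε → 0ℚ < ε → ∃ λ k → 1ℚ ≤ ι (suc k) * ε
  archimedean ε@(ℚ.mkℚ (ℤ.+ suc a) b _) _ = b , ℚₚ.toℚᵘ-cancel-≤ (ℚᵘₚ.≤-respʳ-≃
    (ℚᵘₚ.≃-sym (ℚᵘₚ.≃-trans (ℚₚ.toℚᵘ-homo-* (ι (suc b)) ε) (ℚᵘₚ.*-congʳ (toℚᵘ-ι (suc b)))))
    (ℚᵘ.*≤* (ℤ.+≤+ (begin
      1 ℕ.* (1 ℕ.* suc b)             ≡⟨ trans (ℕₚ.*-identityˡ _) (ℕₚ.*-identityˡ (suc b)) ⟩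
      suc b                          ≤⟨ ℕₚ.m≤m*n (suc b) (suc a) ⟩
      suc b ℕ.* suc a                ≡⟨ ℕₚ.*-identityʳ _ ⟨
      suc b ℕ.* suc a ℕ.* 1          ∎))))
    where open ℕₚ.≤-Reasoning
  archimedean (ℚ.mkℚ (ℤ.+ zero) b _) 0<ε = contradiction (ℚ.positive 0<ε) λ ()
  archimedean (ℚ.mkℚ ℤ.-[1+ a ] b _) 0<ε = contradiction (ℚ.positive 0<ε) λ ()

  module _ {c T ε X : ℚ} (Tc≡1 : T * c ≡ 1ℚ) (0≤c : 0ℚ ≤ c) (c≤1 : c ≤ 1ℚ) (0≤X : 0ℚ ≤ X) where

    -- Division by (k + 1)T bounds Y below by c X - c X/(k + 1), and the loss is at most ε X as c ≤
    -- 1 ≤ (k + 1)ε. To avoid division, K times the difference of the two sides is exhibited as a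
    -- sum of two nonnegative products.
    sandwich-lower : ∀ k {Y} → 1ℚ ≤ ι (suc k) * ε → ι k * X ≤ ι (suc k) * (T * Y) → (c - ε) * X ≤ Y
    sandwich-lower k {Y} 1≤kε h = 0≤q-p⇒p≤q (ℚₚ.*-cancelˡ-≤-pos K {{K>0}} (subst₂ _≤_ (sym (ℚₚ.*-zeroʳ K)) identity
      (+-nonNeg (*-nonNeg 0≤c (p≤q⇒0≤q-p h)) (*-nonNeg (p≤q⇒0≤q-p (ℚₚ.≤-trans c≤1 1≤kε)) 0≤X))))
      where
      open ≡-Reasoning
      K : ℚ
      K = ι (suc k)
      K>0 : ℚ.Positive K
      K>0 = ℚₚ.normalize-pos (suc k) 1
      identity : c * (K * (T * Y) - ι k * X) + (K * ε - c) * X ≡ K * (Y - (c - ε) * X)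
      identity = begin
        c * (K * (T * Y) - ι k * X) + (K * ε - c) * X
          ≡⟨ solve 7 (λ c K T Y k X ε → c :* (K :* (T :* Y) :- k :* X) :+ (K :* ε :- c) :* X
                                     := K :* ((T :* c) :* Y) :- (con 1ℚ :+ k) :* (c :* X) :+ K :* (ε :* X)) refl c K T Y (ι k) X ε ⟩
        K * ((T * c) * Y) - (1ℚ + ι k) * (c * X) + K * (ε * X)
          ≡⟨ cong₂ (λ a b → K * (a * Y) - b * (c * X) + K * (ε * X)) Tc≡1 (sym (ι-+ 1 k)) ⟩
        K * (1ℚ * Y) - K * (c * X) + K * (ε * X)
          ≡⟨ solve 5 (λ c K Y X ε → K :* (con 1ℚ :* Y) :- K :* (c :* X) :+ K :* (ε :* X) := K :* (Y :- (c :- ε) :* X)) refl c K Y X ε ⟩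
        K * (Y - (c - ε) * X) ∎

    -- The factors k + 1 and k + 2, in place of k and k + 1, make the excess c X/(k + 1), which the
    -- same condition on k bounds by ε X.
    sandwich-upper : ∀ k {Z} → 1ℚ ≤ ι (suc k) * ε → ι (suc k) * (T * Z) ≤ ι (suc (suc k)) * X → Z ≤ (c + ε) * X
    sandwich-upper k {Z} 1≤kε h = 0≤q-p⇒p≤q (ℚₚ.*-cancelˡ-≤-pos K {{K>0}} (subst₂ _≤_ (sym (ℚₚ.*-zeroʳ K)) identity
      (+-nonNeg (*-nonNeg 0≤c (p≤q⇒0≤q-p h)) (*-nonNeg (p≤q⇒0≤q-p (ℚₚ.≤-trans c≤1 1≤kε)) 0≤X))))
      where
      open ≡-Reasoning
      K : ℚ
      K = ι (suc k)
      K>0 : ℚ.Positive K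
      K>0 = ℚₚ.normalize-pos (suc k) 1
      identity : c * (ι (suc (suc k)) * X - K * (T * Z)) + (K * ε - c) * X ≡ K * ((c + ε) * X - Z)
      identity = begin
        c * (ι (suc (suc k)) * X - K * (T * Z)) + (K * ε - c) * X
          ≡⟨ cong (λ a → c * (a * X - K * (T * Z)) + (K * ε - c) * X) (ι-+ 1 (suc k)) ⟩
        c * ((1ℚ + K) * X - K * (T * Z)) + (K * ε - c) * X
          ≡⟨ solve 6 (λ c K T Z X ε → c :* ((con 1ℚ :+ K) :* X :- K :* (T :* Z)) :+ (K :* ε :- c) :* X
                                   := K :* ((c :+ ε) :* X) :- K :* ((T :* c) :* Z)) refl c K T Z X ε ⟩
        K * ((c + ε) * X) - K * ((T * c) * Z)
          ≡⟨ cong (λ a → K * ((c + ε) * X) - K * (a * Z)) Tc≡1 ⟩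
        K * ((c + ε) * X) - K * (1ℚ * Z)
          ≡⟨ solve 5 (λ c K Z X ε → K :* ((c :+ ε) :* X) :- K :* (con 1ℚ :* Z) := K :* ((c :+ ε) :* X :- Z)) refl c K Z X ε ⟩
        K * ((c + ε) * X - Z) ∎

-- The chain of bounds for the path

module PathBounds (d t : ℕ) where

  open RawSemiring ℚ.+-*-rawSemiring using (_^_)

  r T s : ℕ
  r = suc d
  T = suc t
  s = T ℕ.* r

  first : Embedding r s
  first = window 0 r s (ℕₚ.m≤n*m r T)

  first∈ : first ∈ edges (P r s)
  first∈ = window∈edges 0 r s (ℕₚ.m≤n*m r T)

  module At (n : ℕ) = Optimisation (P r s) first∈ n

  ν : ℕ → ℕ
  ν n = proj₁ (At.ν-exists n)

  q : ℕ → ℚ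
  q n = At.optimalValue n

  ν-isν : ∀ n → Isν n (P r s) (ν n)
  ν-isν n = proj₂ (At.ν-exists n)

  C-floor≤ν : ∀ n → (n ℕ./ T) C r ℕ.≤ ν n
  C-floor≤ν n = bound (n ℕ./ T) (t*[n/t]≤n T n)
    where
    bound : ∀ m → T ℕ.* m ℕ.≤ n → m C r ℕ.≤ ν n
    -- The periodic packing is read modulo m and so needs m ≥ 1; for m = 0 the binomial is 0 because
    -- r ≥ 1.
    bound zero    _    = z≤n
    bound (suc m) Tm≤n = proj₂ (ν-isν n) (suc m C r)
      (periodicPacking r T (suc m) n Tm≤n ,
       periodicPacking-isPacking r T (suc m) n Tm≤n ,
       length-periodicPacking r T (suc m) n Tm≤n)

  ν≤q : ∀ n → ι (ν n) ℚ.≤ q n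
  ν≤q n = At.ν≤optimalValue n (ν-isν n)

  q≤C-ceiling : ∀ n → q n ℚ.≤ ι (suc (n ℕ./ T) C r)
  q≤C-ceiling n = ℚₚ.≤-trans
    (At.optimalValue≤ n (0≤intervalWeight d t m n n≤) (intervalWeight-covers d t m n n≤))
    (∑-intervalWeight d t m n n≤)
    where
    m : ℕ
    m = suc (n ℕ./ T)
    n≤ : n ℕ.≤ T ℕ.* m
    n≤ = n≤t*[1+n/t] T n

  c : ℚ
  c = (ℤ.+ r ℚ./ s) ^ r

  T^r*c≡1 : ι (T ℕ.^ r) ℚ.* c ≡ 1ℚ
  T^r*c≡1 = ι^*^ T (ℤ.+ r ℚ./ s) (ι*[d/td] T r) r

  0≤c : 0ℚ ℚ.≤ c
  0≤c = ^-nonNeg (ℚₚ.nonNegative⁻¹ (ℤ.+ r ℚ./ s) {{ℚₚ.normalize-nonNeg r s}}) r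

  c≤1 : c ℚ.≤ 1ℚ
  c≤1 = subst₂ ℚ._≤_ (ℚₚ.*-identityˡ c) T^r*c≡1 (*-monoʳ 0≤c (ι-mono {1} {T ℕ.^ r} (ℕₚ.m^n>0 T r)))

  sandwich : ∀ ε → 0ℚ ℚ.< ε → ∃ λ N → ∀ n → N ℕ.≤ n →
    (c ℚ.- ε) ℚ.* ι (n C r) ℚ.≤ ι ((n ℕ./ T) C r) × ι (suc (n ℕ./ T) C r) ℚ.≤ (c ℚ.+ ε) ℚ.* ι (n C r)
  sandwich ε 0<ε =
    let k , 1≤kε = archimedean ε 0<ε
        M , lower = C-floor-asymptotic T r k
        N , upper = C-ceiling-asymptotic T r (suc k)
    in M ℕ.⊔ N , λ n h →
      sandwich-lower {c} {ι (T ℕ.^ r)} {ε} {ι (n C r)} T^r*c≡1 0≤c c≤1 (0≤ι (n C r)) k 1≤kε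
        (subst₂ ℚ._≤_ (ι-* k (n C r))
          (trans (ι-* (suc k) (T ℕ.^ r ℕ.* ((n ℕ./ T) C r))) (cong (ι (suc k) ℚ.*_) (ι-* (T ℕ.^ r) ((n ℕ./ T) C r))))
          (ι-mono (lower n (ℕₚ.m⊔n≤o⇒m≤o M N h)))) ,
      sandwich-upper {c} {ι (T ℕ.^ r)} {ε} {ι (n C r)} T^r*c≡1 0≤c c≤1 (0≤ι (n C r)) k 1≤kε
        (subst₂ ℚ._≤_
          (trans (ι-* (suc k) (T ℕ.^ r ℕ.* (suc (n ℕ./ T) C r))) (cong (ι (suc k) ℚ.*_) (ι-* (T ℕ.^ r) (suc (n ℕ./ T) C r))))
          (ι-* (suc (suc k)) (n C r))
          (ι-mono (upper n (ℕₚ.m⊔n≤o⇒n≤o M N h))))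

  -- Any sequence squeezed between ν and the common optimum of the programs inherits both binomial
  -- bounds, which serves all three quantities at once.
  asymptotics : ∀ (a : ℕ → ℚ) → (∀ n → ι (ν n) ℚ.≤ a n) → (∀ n → a n ℚ.≤ q n) → (fromℚ ∘ a) ≈[ c +o1]binom r
  asymptotics a ν≤a a≤q ε 0<ε = let N , h = sandwich ε 0<ε in N , λ n N≤n →
    ≤⇒≤ℝ {fromℚ ((c ℚ.- ε) ℚ.* ι (n C r))} {fromℚ (a n)}
      (λ _ → ℚₚ.≤-trans (proj₁ (h n N≤n)) (ℚₚ.≤-trans (ι-mono (C-floor≤ν n)) (ν≤a n))) ,
    ≤⇒≤ℝ {fromℚ (a n)} {fromℚ ((c ℚ.+ ε) ℚ.* ι (n C r))}
      (λ _ → ℚₚ.≤-trans (ℚₚ.≤-trans (a≤q n) (q≤C-ceiling n)) (proj₂ (h n N≤n)))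

open import Algebra.Definitions.RawSemiring using (_^_)
open import Data.Integer using (+_)
open import Data.Rational using (_/_; +-*-rawSemiring)

theorem3p3 : (r s : ℕ) .{{_ : NonZero r}} .{{_ : NonZero s}} → r ∣ s →
    let c = _^_ +-*-rawSemiring (+ r / s) r in
    (∃ λ (ν : ℕ → ℕ) → (∀ n → Isν n (P r s) (ν n)) × ((λ n → fromℕ (ν n)) ≈[ c +o1]binom r)) ×
    (∃ λ (ν* : ℕ → ℝ) → (∀ n → Isν* n (P r s) (ν* n)) × (ν* ≈[ c +o1]binom r)) ×
    (∃ λ (τ* : ℕ → ℝ) → (∀ n → Isτ* n (P r s) (τ* n)) × (τ* ≈[ c +o1]binom r))
theorem3p3 zero    _                  _                    = contradiction refl (ℕ.≢-nonZero⁻¹ 0)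
theorem3p3 (suc d) .(zero ℕ.* suc d)  (divides zero refl)    = contradiction refl (ℕ.≢-nonZero⁻¹ 0)
theorem3p3 (suc d) .(suc t ℕ.* suc d) (divides (suc t) refl) =
  (ν , ν-isν , asymptotics (ι ∘ ν) (λ _ → ℚₚ.≤-refl) ν≤q) ,
  (fromℚ ∘ q , At.ν*-optimalValue , asymptotics q ν≤q (λ _ → ℚₚ.≤-refl)) ,
  (fromℚ ∘ q , At.τ*-optimalValue , asymptotics q ν≤q (λ _ → ℚₚ.≤-refl))
  where open PathBounds d t
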